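{- Let $D$ be a non-elliptic web (so that $[D]$ is a nonzero web invariant) with boundary vertices numbered $1,\dots,n$ clockwise, of arbitrary degrees. Let $\tilde\ell$ be the proper edge coloring of the unclasping $\tilde D$ determined by the KK-labeling of $\tilde D$, let $\ell$ be the induced proper edge coloring of $D$, and let $m$ be the monomial $\prod_{i\text{ black}}\prod_{e\ni i} x_{\ell(e),i}\prod_{i\text{ white}}\prod_{e\ni i} y_{i,\ell(e)}$ (products over edges $e$ incident to boundary vertex $i$). Then $m$ is the leading monomial of $[D]$ with respect to the graded reverse lexicographic order described below, and the coefficient of $m$ in $[D]$ is $\pm1$.
   Context: A tensor diagram is a finite bipartite graph with a fixed proper coloring of its vertices by black and white, a fixed partition of its vertices into boundary and internal vertices, such that every internal vertex has degree $3$ and carries a fixed cyclic order of its incident edges. A web is a tensor diagram embedded in an oriented disk, boundary vertices on the boundary circle, edges not crossing or touching except at endpoints. It is non-elliptic if it has no multiple edges and no $4$-cycle all of whose vertices are internal. A proper edge coloring is an assignment of colors in $\{ -1,0,1\}$ to edges such that the three edges at each internal vertex have distinct colors. Invariant: to boundary vertex $i$ attach variables $x_{ -1,i},x_{0,i},x_{1,i}$ if $i$ is black and $y_{i,-1},y_{i,0},y_{i,1}$ if $i$ is white; these $3n$ variables generate a polynomial ring. Then $[D]=\sum_{\ell}\big(\prod_{v\text{ internal}}\operatorname{sign}(\ell(v))\big)\prod_{i\text{ black}}\prod_{e\ni i}x_{\ell(e),i}\prod_{i\text{ white}}\prod_{e\ni i}y_{i,\ell(e)}$, summed over all proper edge colorings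 $\ell$ of $D$, where $\operatorname{sign}(\ell(v))=+1$ if the colors of the three edges at $v$, read in their cyclic order, form a cyclic rotation of $(-1,0,1)$, and $-1$ otherwise. Monomial order: list the variables as $z_1,\dots,z_{3n}$ by taking vertices $i=1,\dots,n$ in turn and listing $x_{ -1,i},x_{0,i},x_{1,i}$ (in this order) if $i$ is black, and $y_{i,1},y_{i,0},y_{i,-1}$ (in this order) if $i$ is white. For exponent vectors $\alpha,\beta$, $z^\alpha>z^\beta$ if $\sum\alpha_k>\sum\beta_k$, or the sums are equal and at the smallest index $j$ with $\alpha_j\ne\beta_j$ one has $\alpha_j<\beta_j$. The leading monomial of a nonzero polynomial is the largest monomial occurring in it with nonzero coefficient. Unclasping: $\tilde D$ is obtained from $D$ by replacing each boundary vertex $i$ of degree $d_i$ with $d_i$ boundary vertices $i_1,\dots,i_{d_i}$ of the same color, in clockwise order along the boundary, each being the endpoint of exactly one of the edges formerly incident to $i$; its boundary vertices are numbered clockwise $1_1,\dots,1_{d_1},2_1,\dots$. Then $\tilde D$ is a non-elliptic web with all boundary vertices of degree $1$, and edges of $\tilde D$ correspond bijectively to edges of $D$, so colorings of $\tilde D$ induce colorings of $D$. Sign and state strings and KK-labeling: a sign and state string is $((s_1,j_1),\dots,(s_N,j_N))$ with $s_k\in\{+,-\}$, $j_k\in\{ -1,0,1\}$. Weights: $(+,1)\mapsto(1,0)$, $(+,0)\mapsto(-1/2,\sqrt3/2)$, $(+,-1)\mapsto(-1/2,-\sqrt3/2)$, weight of $(-,j)$ is minus that of $(+,-j)$; path $\pi_0=0$,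 $\pi_k=\pi_{k-1}+$weight of $(s_k,j_k)$; dominant if $\pi_N=0$ and all $\pi_k\in\{a(1,0)+b(1/2,\sqrt3/2):a,b\ge0\}$. Growth algorithm: place $N$ vertices left to right on a segment, vertex $k$ black iff $s_k=+$, each with a downward dangling edge labeled $(s_k,j_k)$; repeatedly apply a rule to two adjacent dangling edges labeled $(s,j)$ (left), $(s',j')$ (right): if $s'=-s$ and $(j,j')\in\{(1,0),(0,0),(0,-1)\}$, join each to a new internal vertex, connect those by an unlabeled horizontal edge, and draw from each a new dangling edge, labeled (left, right) $(-s,0),(s,1)$, resp. $(-s,-1),(s,1)$, resp. $(-s,-1),(s,0)$; if $s'=-s$ and $(j,j')=(1,-1)$, join them into one edge; if $s'=s$ and $(j,j')=(1,0),(0,-1),(1,-1)$, join both to a new internal vertex with one new dangling edge labeled $(-s,1)$, resp. $(-s,-1)$, resp. $(-s,0)$. Close the segment so left-to-right becomes clockwise. By Khovanov–Kuperberg, every non-elliptic web with all boundary vertices of degree $1$ and boundary numbered clockwise arises, independently of the choices, from exactly one dominant string (with $s_k=+$ iff vertex $k$ black); its state string is the KK-labeling. The coloring determined by the KK-labeling gives an edge labeled $(+,j)$ color $j$, an edge labeled $(-,j)$ color $-j$, and each horizontal edge the unique color making the coloring proper. -}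

module Defs where

open import Data.Nat as ℕ using (ℕ; zero; suc; _≤_; _<_; _≡ᵇ_; _≤ᵇ_)
open import Data.Fin as F using (Fin; zero; suc; toℕ; fromℕ; inject₁; lower₁)
open import Data.Fin.Properties using () renaming (_≟_ to _≟F_)
open import Data.Bool using (Bool; true; false; _∧_; _∨_; not; if_then_else_)
open import Data.Integer as ℤ using (ℤ; 0ℤ; 1ℤ; -1ℤ)
open import Data.Product using (Σ; ∃; ∃-syntax; _×_; _,_; proj₁; proj₂)
open import Data.Sum using (_⊎_; inj₁; inj₂)
open import Data.Maybe using (Maybe; just; nothing)
open import Data.List using (List; []; _∷_; _++_; map; concatMap; allFin; upTo; length; lookup; foldr)
open import Data.Bool.ListAction using (all; any)
open import Data.Empty using (⊥)
open import Relation.Nullary using (¬_; yes; no)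
open import Relation.Binary.PropositionalEquality using (_≡_; _≢_; refl)
open import Relation.Binary.Construct.Closure.ReflexiveTransitive using (Star)
open import Function.Bundles using (_↔_; Inverse)

-- vertex colours (also used to name the two ends of an edge:
-- the 'black' end and the 'white' end of a bipartite edge)
data VColor : Set where
  black white : VColor

-- edge colours / states  -1, 0, 1
data Col : Set where
  m1 z0 p1 : Col

data Sgn : Set where
  plus minus : Sgn

negC : Col → Col
negC m1 = p1
negC z0 = z0
negC p1 = m1

negS : Sgn → Sgn
negS plus = minus
negS minus = plus

_==C_ : Col → Col → Bool
m1 ==C m1 = true
z0 ==C z0 = true
p1 ==C p1 = true
_  ==C _  = false

suc3 : Fin 3 → Fin 3
suc3 zero = suc zero
suc3 (suc zero) = suc (suc zero)
suc3 (suc (suc zero)) = zero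

add3 : Fin 3 → Fin 3 → Fin 3
add3 i zero = i
add3 i (suc zero) = suc3 i
add3 i (suc (suc zero)) = suc3 (suc3 i)

nextF : ∀ {N} → Fin N → Fin N
nextF {suc m} i with suc m ℕ.≟ suc (toℕ i)
... | yes _ = zero
... | no ne = lower₁ (suc i) ne

prevF : ∀ {N} → Fin N → Fin N
prevF {suc m} zero = fromℕ m
prevF {suc m} (suc i) = inject₁ i

countB : {A : Set} → (A → Bool) → List A → ℕ
countB p [] = 0
countB p (x ∷ xs) = (if p x then 1 else 0) ℕ.+ countB p xs

⌊_⌋ᵇ : {P : Set} → Relation.Nullary.Dec P → Bool
⌊ yes _ ⌋ᵇ = true
⌊ no _ ⌋ᵇ = false

iter : {A : Set} → (A → A) → ℕ → A → A
iter f zero x = x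
iter f (suc j) x = f (iter f j x)

-- boundary vertices Fin n, internal vertices Fin k, edges Fin E.
-- Each edge is recorded by its black end and its white end.
-- rot v : Fin 3 → Fin E lists the three edges at internal vertex v
-- in their cyclic order (up to rotation).
record TensorDiagram : Set where
  field
    n k E : ℕ
    bcol : Fin n → VColor
    icol : Fin k → VColor
    bEnd wEnd : Fin E → Fin n ⊎ Fin k
    bEnd-black : ∀ e → Data.Sum.[ bcol , icol ] (bEnd e) ≡ black
    wEnd-white : ∀ e → Data.Sum.[ bcol , icol ] (wEnd e) ≡ white
    rot : Fin k → Fin 3 → Fin E
    rot-inj : ∀ v i j → rot v i ≡ rot v j → i ≡ j
    rot-inc : ∀ v j → (bEnd (rot v j) ≡ inj₂ v) ⊎ (wEnd (rot v j) ≡ inj₂ v)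
    rot-all : ∀ v e → (bEnd e ≡ inj₂ v) ⊎ (wEnd e ≡ inj₂ v) → ∃[ j ] rot v j ≡ e

module _ (T : TensorDiagram) where
  open TensorDiagram T

  endAt : VColor → Fin E → Fin n ⊎ Fin k
  endAt black e = bEnd e
  endAt white e = wEnd e

-- Boundary order data: the N = Σ dᵢ edge-ends at boundary vertices, listed
-- in clockwise order along the boundary circle (the boundary vertices
-- 1_1,…,1_{d_1},2_1,… of the unclasping).  bp t = (edge, side) of the t-th one,
-- bpv t = the boundary vertex of D it sits at.
record BoundaryOrder (T : TensorDiagram) : Set where
  open TensorDiagram T
  field
    N : ℕ
    bp : Fin N → Fin E × VColor
    bpv : Fin N → Fin n
    bp-at : ∀ t → endAt T (proj₂ (bp t)) (proj₁ (bp t)) ≡ inj₁ (bpv t)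
    bp-inj : ∀ t t' → bp t ≡ bp t' → t ≡ t'
    bp-surj : ∀ e s i → endAt T s e ≡ inj₁ i → ∃[ t ] bp t ≡ (e , s)
    bp-mono : ∀ t t' → toℕ t ≤ toℕ t' → toℕ (bpv t) ≤ toℕ (bpv t')

-- The combinatorial map of the unclasped web together with the boundary
-- circle (N arcs, arc t going from boundary point t to point t+1 mod N).
-- Darts: half-edges (e , side) and arc-darts (t , true = forward from t,
-- false = backward, i.e. starting at t+1).
-- σ = clockwise rotation around the origin vertex, α = dart reversal.

module Map (T : TensorDiagram) (B : BoundaryOrder T) where
  open TensorDiagram T
  open BoundaryOrder B

  Dart : Set
  Dart = (Fin E × VColor) ⊎ (Fin N × Bool)

  sideN : VColor → ℕ
  sideN black = 0
  sideN white = 1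

  boolN : Bool → ℕ
  boolN false = 0
  boolN true = 1

  idx : Dart → ℕ
  idx (inj₁ (e , s)) = 2 ℕ.* toℕ e ℕ.+ sideN s
  idx (inj₂ (t , b)) = 2 ℕ.* E ℕ.+ 2 ℕ.* toℕ t ℕ.+ boolN b

  eqD : Dart → Dart → Bool
  eqD x y = idx x ≡ᵇ idx y

  allDarts : List Dart
  allDarts = map inj₁ (concatMap (λ e → (e , black) ∷ (e , white) ∷ []) (allFin E))
          ++ map inj₂ (concatMap (λ t → (t , true) ∷ (t , false) ∷ []) (allFin N))

  nD : ℕ
  nD = length allDarts

  -- position of e in rot v (default 0; never used when e is at v)
  findRot : Fin k → Fin E → Fin 3
  findRot v e = go (allFin 3)
    where
      go : List (Fin 3) → Fin 3
      go [] = zero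
      go (j ∷ js) with rot v j ≟F e
      ... | yes _ = j
      ... | no _ = go js

  findBp : Fin E × VColor → Maybe (Fin N)
  findBp (e , s) = go (allFin N)
    where
      go : List (Fin N) → Maybe (Fin N)
      go [] = nothing
      go (t ∷ ts) = if (toℕ (proj₁ (bp t)) ≡ᵇ toℕ e) ∧ (sideN (proj₂ (bp t)) ≡ᵇ sideN s)
                    then just t else go ts

  σ : Dart → Dart
  σ (inj₁ (e , s)) with endAt T s e
  ... | inj₂ v = inj₁ (rot v (suc3 (findRot v e)) , icol v)
  ... | inj₁ _ with findBp (e , s)
  ...   | just t = inj₂ (prevF t , false)
  ...   | nothing = inj₁ (e , s)
  σ (inj₂ (t , true)) = inj₁ (bp t)
  σ (inj₂ (t , false)) = inj₂ (nextF t , true)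

  flipS : VColor → VColor
  flipS black = white
  flipS white = black

  α : Dart → Dart
  α (inj₁ (e , s)) = inj₁ (e , flipS s)
  α (inj₂ (t , b)) = inj₂ (t , not b)

  φ : Dart → Dart
  φ x = σ (α x)

  cycles : (Dart → Dart) → ℕ
  cycles f = countB (λ x → all (λ j → idx x ≤ᵇ idx (iter f j x)) (upTo nD)) allDarts

  Conn : Dart → Dart → Set
  Conn = Star (λ a b → (b ≡ σ a) ⊎ (b ≡ α a))

  -- genus 0 (every connected component spherical):  V - E + F = 2 C,
  -- C = number of components, given by a labelling c of the darts by Fin C
  -- whose fibres are exactly the components
  DiskPlanar : Set
  DiskPlanar = Σ ℕ λ C → Σ (Dart → Fin C) λ c →
    (∀ x → c (σ x) ≡ c x) × (∀ x → c (α x) ≡ c x)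
    × (∀ i → ∃[ x ] c x ≡ i) × (∀ x y → c x ≡ c y → Conn x y)
    × (cycles σ ℕ.+ cycles φ ≡ cycles α ℕ.+ 2 ℕ.* C)

-- A web: tensor diagram + boundary order + planarity of the resulting map,
-- where the internal cyclic orders are the clockwise orders of the embedding.
record Web : Set where
  field
    diag : TensorDiagram
    bord : BoundaryOrder diag
    planar : Map.DiskPlanar diag bord

module W (D : Web) where
  open Web D public
  open TensorDiagram diag public
  open BoundaryOrder bord public

NonElliptic : Web → Set
NonElliptic D =
  (∀ e e' → bEnd e ≡ bEnd e' → wEnd e ≡ wEnd e' → e ≡ e')
  × ¬ (Σ (Fin k) λ b₁ → Σ (Fin k) λ b₂ → Σ (Fin k) λ w₁ → Σ (Fin k) λ w₂ →
         b₁ ≢ b₂ × w₁ ≢ w₂ × Adj b₁ w₁ × Adj b₁ w₂ × Adj b₂ w₁ × Adj b₂ w₂)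
  where
    open W D
    Adj : Fin k → Fin k → Set
    Adj b w = ∃[ e ] (bEnd e ≡ inj₂ b × wEnd e ≡ inj₂ w)

-- monomials: exponent of variable number r (0,1,2) at boundary vertex i
Mono : ℕ → Set
Mono n = Fin n → Fin 3 → ℕ

-- colour belonging to variable r at a vertex of given colour:
-- black: x_{-1,i}, x_{0,i}, x_{1,i};  white: y_{i,1}, y_{i,0}, y_{i,-1}
varCol : VColor → Fin 3 → Col
varCol black zero = m1
varCol black (suc zero) = z0
varCol black (suc (suc zero)) = p1
varCol white zero = p1
varCol white (suc zero) = z0
varCol white (suc (suc zero)) = m1

flatten : ∀ {n} → Mono n → List ℕ
flatten {n} μ = concatMap (λ i → map (μ i) (allFin 3)) (allFin n)

sumℕ : List ℕ → ℕ
sumℕ = foldr ℕ._+_ 0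

RevGt : List ℕ → List ℕ → Set
RevGt (a ∷ as) (b ∷ bs) = (a < b) ⊎ (a ≡ b × RevGt as bs)
RevGt _ _ = ⊥

_>ₘ_ : ∀ {n} → Mono n → Mono n → Set
α >ₘ β = (sumℕ (flatten β) < sumℕ (flatten α))
       ⊎ (sumℕ (flatten α) ≡ sumℕ (flatten β) × RevGt (flatten α) (flatten β))

eqL : List ℕ → List ℕ → Bool
eqL [] [] = true
eqL (a ∷ as) (b ∷ bs) = (a ≡ᵇ b) ∧ eqL as bs
eqL _ _ = false

allCols : (E : ℕ) → List (Fin E → Col)
allCols zero = (λ ()) ∷ []
allCols (suc E) = concatMap (λ c → map (λ f → cons c f) (allCols E)) (m1 ∷ z0 ∷ p1 ∷ [])
  where
    cons : Col → (Fin E → Col) → Fin (suc E) → Col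
    cons c f zero = c
    cons c f (suc i) = f i

sgn3 : Col → Col → Col → ℤ
sgn3 m1 z0 p1 = 1ℤ
sgn3 z0 p1 m1 = 1ℤ
sgn3 p1 m1 z0 = 1ℤ
sgn3 _ _ _ = -1ℤ

distinct3 : Col → Col → Col → Bool
distinct3 a b c = not (a ==C b) ∧ not (b ==C c) ∧ not (a ==C c)

module Inv (D : Web) where
  open W D

  isBnd : Fin n ⊎ Fin k → Fin n → Bool
  isBnd (inj₁ i) j = toℕ i ≡ᵇ toℕ j
  isBnd (inj₂ _) j = false

  mon : (Fin E → Col) → Mono n
  mon ℓ i r = countB (λ e → (isBnd (bEnd e) i ∨ isBnd (wEnd e) i) ∧ (ℓ e ==C varCol (bcol i) r)) (allFin E)

  proper : (Fin E → Col) → Bool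
  proper ℓ = all (λ v → distinct3 (ℓ (rot v zero)) (ℓ (rot v (suc zero))) (ℓ (rot v (suc (suc zero))))) (allFin k)

  sign : (Fin E → Col) → ℤ
  sign ℓ = foldr ℤ._*_ 1ℤ (map (λ v → sgn3 (ℓ (rot v zero)) (ℓ (rot v (suc zero))) (ℓ (rot v (suc (suc zero))))) (allFin k))

  coeff : Mono n → ℤ
  coeff μ = foldr ℤ._+_ 0ℤ
    (map (λ ℓ → if proper ℓ ∧ eqL (flatten (mon ℓ)) (flatten μ) then sign ℓ else 0ℤ) (allCols E))

  IsLeading : Mono n → Set
  IsLeading μ = (coeff μ ≢ 0ℤ) × (∀ μ' → μ' >ₘ μ → coeff μ' ≡ 0ℤ)

-- Sign and state strings, dominance (weights written in the basis
-- e₁ = (1,0), e₂ = (1/2, √3/2); the cone is {a e₁ + b e₂ : a,b ≥ 0})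

weight : Sgn × Col → ℤ × ℤ
weight (plus , p1) = (ℤ.+ 1 , ℤ.+ 0)
weight (plus , z0) = (-1ℤ , ℤ.+ 1)
weight (plus , m1) = (ℤ.+ 0 , -1ℤ)
weight (minus , p1) = (ℤ.+ 0 , ℤ.+ 1)
weight (minus , z0) = (ℤ.+ 1 , -1ℤ)
weight (minus , m1) = (-1ℤ , ℤ.+ 0)

DomFrom : ℤ × ℤ → List (Sgn × Col) → Set
DomFrom (a , b) [] = (a ≡ 0ℤ) × (b ≡ 0ℤ)
DomFrom (a , b) (x ∷ xs) =
  (0ℤ ℤ.≤ a ℤ.+ proj₁ (weight x)) × (0ℤ ℤ.≤ b ℤ.+ proj₂ (weight x))
  × DomFrom (a ℤ.+ proj₁ (weight x) , b ℤ.+ proj₂ (weight x)) xs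

Dominant : ∀ {N} → (Fin N → Sgn × Col) → Set
Dominant {N} str = DomFrom (0ℤ , 0ℤ) (map str (allFin N))

-- Growth algorithm.  Vertices of the grown web: boundary vertices bnd t
-- (t = 0,…,N-1) and internal vertices int v slot (v = 0,1,…), where slot
-- is the position of the edge in the clockwise order at v.

data GEnd : Set where
  bnd : ℕ → GEnd
  int : ℕ → Fin 3 → GEnd

record GEdge : Set where
  constructor gedge
  field
    gb gw : GEnd
    gc : Col

record Dang : Set where
  constructor dang
  field
    dsgn : Sgn
    dst : Col
    dtop : GEnd       -- upper end (a vertex of colour dsgn: + black)

record GState : Set where
  constructor gstate
  field
    nxt : ℕ
    dangl : List Dang
    done : List GEdge

-- colour of an edge labelled (s , j)
ecol : Sgn → Col → Col
ecol plus j = j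
ecol minus j = negC j

orient : Sgn → GEnd → GEnd → Col → GEdge
orient plus x y c = gedge x y c
orient minus x y c = gedge y x c

third : Col → Col → Col
third m1 z0 = p1
third z0 m1 = p1
third m1 p1 = z0
third p1 m1 = z0
third z0 p1 = m1
third p1 z0 = m1
third _ _ = z0

-- H-rule table: (j , j') ↦ (new left state, new right state)
data HTab : Col → Col → Col → Col → Set where
  h10 : HTab p1 z0 z0 p1
  h00 : HTab z0 z0 m1 p1
  h0m : HTab z0 m1 m1 z0

-- Y-rule table: (j , j') ↦ new state
data YTab : Col → Col → Col → Set where
  y10 : YTab p1 z0 p1
  y0m : YTab z0 m1 m1
  y1m : YTab p1 m1 z0

data Step : GState → GState → Set where
  hRule : ∀ nx pre post dn s ta tb j j' ja jb → HTab j j' ja jb →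
    Step (gstate nx (pre ++ dang s j ta ∷ dang (negS s) j' tb ∷ post) dn)
         (gstate (suc (suc nx))
                 (pre ++ dang (negS s) ja (int nx (suc (suc zero)))
                        ∷ dang s jb (int (suc nx) (suc zero)) ∷ post)
                 (dn ++ orient s ta (int nx zero) (ecol s j)
                      ∷ orient (negS s) tb (int (suc nx) zero) (ecol (negS s) j')
                      ∷ orient s (int (suc nx) (suc (suc zero))) (int nx (suc zero))
                               (third (ecol s j) (ecol (negS s) ja))
                      ∷ []))
  joinRule : ∀ nx pre post dn s ta tb →
    Step (gstate nx (pre ++ dang s p1 ta ∷ dang (negS s) m1 tb ∷ post) dn)
         (gstate nx (pre ++ post) (dn ++ orient s ta tb (ecol s p1) ∷ []))
  yRule : ∀ nx pre post dn s ta tb j j' j'' → YTab j j' j'' →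
    Step (gstate nx (pre ++ dang s j ta ∷ dang s j' tb ∷ post) dn)
         (gstate (suc nx)
                 (pre ++ dang (negS s) j'' (int nx (suc (suc zero))) ∷ post)
                 (dn ++ orient s ta (int nx zero) (ecol s j)
                      ∷ orient s tb (int nx (suc zero)) (ecol s j') ∷ []))

initState : ∀ {N} → (Fin N → Sgn × Col) → GState
initState {N} str = gstate 0 (map (λ t → dang (proj₁ (str t)) (proj₂ (str t)) (bnd (toℕ t))) (allFin N)) []

gEnd : VColor → GEdge → GEnd
gEnd black g = GEdge.gb g
gEnd white g = GEdge.gw g

sgnCol : Sgn → VColor
sgnCol plus = black
sgnCol minus = white

-- ℓ is the colouring of D induced by the colouring of the unclasping D̃
-- determined by its KK-labeling: there is a dominant sign and state string
-- whose growth produces a web isomorphic to D̃ (boundary point t of D̃ is the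
-- edge-end bp t of D), and ℓ is the transported colouring.
KKColoring : (D : Web) → (Fin (W.E D) → Col) → Set
KKColoring D ℓ =
  Σ (Fin N → Sgn × Col) λ str →
    Dominant str
    × (∀ t → sgnCol (proj₁ (str t)) ≡ bcol (bpv t))
    × Σ GState λ F →
        Star Step (initState str) F
        × GState.dangl F ≡ []
        × Σ (Fin k ↔ Fin (GState.nxt F)) λ φV →
          Σ (Fin E ↔ Fin (length (GState.done F))) λ φE →
          Σ (Fin k → Fin 3) λ r →
            (∀ v j → gEnd (icol v) (lookup (GState.done F) (Inverse.to φE (rot v j)))
                       ≡ int (toℕ (Inverse.to φV v)) (add3 j (r v)))
            × (∀ t → gEnd (proj₂ (bp t)) (lookup (GState.done F) (Inverse.to φE (proj₁ (bp t))))
                       ≡ bnd (toℕ t))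
            × (∀ e → ℓ e ≡ GEdge.gc (lookup (GState.done F) (Inverse.to φE e)))
  where open W D

{-# OPTIONS --safe #-}

-- A proper colouring gives every edge a weight, and at each internal vertex the weights
-- balance; so a growth step, for the KK-colouring and for any other proper colouring
-- alike, changes the path of partial sums along the dangling edges only strictly inside
-- the rewritten segment.  Reading the growth backwards from the empty string, one sees
-- that the KK-path dominates (in the root order) the path of every proper colouring at
-- every point: inside the segment the left edge is highest, or the right edge is lowest,
-- or the rule is (0,0), where dominance one step later suffices.
--
-- Dominance at the last edge of each boundary vertex implies that no proper
-- colouring has a larger monomial.  If the monomials agree, then the two paths meet
-- between any two boundary vertices.  A descent of the KK-states at one vertex would
-- make its two edges end at a common internal vertex, hence be a double edge; so the
-- KK-states at each vertex increase, which makes the KK-path the lowest one with the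
-- given monomial.  The paths therefore coincide, and the boundary colours determine the
-- whole colouring, since the only free choice, in rule (0,0), is settled by dominance.
-- So exactly one colouring contributes to the coefficient.
module Submission where

open import Defs
open import Data.Nat as ℕ using (ℕ; zero; suc; _+_; _≤_; _<_; z≤n; s≤s; _≡ᵇ_; _<ᵇ_; _<?_)
open import Data.Nat.Properties hiding (_≟_; _<?_)
open import Data.Nat.Solver using (module +-*-Solver)
open +-*-Solver using (solve; _:+_; _:=_)
open import Data.Fin using (Fin; zero; suc; toℕ; fromℕ<)
open import Data.Fin.Properties using (_≟_; toℕ-injective; toℕ-fromℕ<; toℕ<n; fromℕ<-toℕ)
open import Data.Fin.Patterns using (0F; 1F; 2F)
open import Data.Bool using (Bool; true; false; _∧_; _∨_; if_then_else_)
open import Data.Bool.ListAction using (all)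
open import Data.Bool.Properties using (T-≡)
open import Data.Integer as ℤ using (ℤ; 0ℤ; 1ℤ; -1ℤ)
import Data.Integer.Properties as ℤ
open import Data.Product using (∃-syntax; _×_; _,_; proj₁; proj₂)
open import Data.Sum using (_⊎_; inj₁; inj₂; [_,_])
open import Data.Sum.Properties using (inj₁-injective)
open import Data.List using (List; []; _∷_; _++_; map; foldr; length; lookup; tabulate; allFin; concat)
open import Data.List.Properties using (++-assoc; ++-identityʳ; map-tabulate; map-cong; tabulate-lookup)
open import Data.List.Relation.Unary.All as All using (All; []; _∷_)
open import Data.List.Relation.Unary.All.Properties using (++⁺; ++⁻ˡ; ++⁻ʳ; tabulate⁺; tabulate⁻)
open import Data.List.Relation.Unary.Any using (here; there; index)
open import Data.List.Relation.Unary.Any.Properties using (lookup-index)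
open import Data.List.Membership.Propositional using (_∈_)
open import Data.List.Membership.Propositional.Properties using (∈-lookup; ∈-++⁺ˡ; ∈-++⁺ʳ)
open import Data.Empty using (⊥; ⊥-elim)
open import Relation.Nullary using (¬_; Dec; yes; no; contradiction)
open import Relation.Binary.PropositionalEquality hiding ([_])
open import Relation.Binary.Construct.Closure.ReflexiveTransitive using (Star; ε; _◅_)
open import Function using (_∘_; id)
open import Function.Bundles using (Equivalence; _↔_; Inverse)
open import Algebra.Properties.CommutativeMonoid.Sum +-0-commutativeMonoid
  using (sum; sum-cong-≗; sum-replicate-zero; ∑-distrib-+; ∑-comm)

-- Growth as rewriting

-- A relation rather than an equation with `negS`: matching on it fixes both signs at once and
-- refutes equal signs.
data Opp : Sgn → Sgn → Set where
  +- : Opp plus minus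
  -+ : Opp minus plus

negS-opp : ∀ s → Opp s (negS s)
negS-opp plus  = +-
negS-opp minus = -+

-- The growth rules in inductive form: the place of the rule is reached through `there`, so proofs
-- go by induction along the string, and the last index lists only the edges completed by this step.
data Rewrite : ℕ → List Dang → ℕ → List Dang → List GEdge → Set where
  H-rule : ∀ {nx s s' j j' ja jb ta tb L} → Opp s s' → HTab j j' ja jb →
    Rewrite nx (dang s j ta ∷ dang s' j' tb ∷ L)
      (2 + nx) (dang s' ja (int nx 2F) ∷ dang s jb (int (suc nx) 1F) ∷ L)
      (orient s ta (int nx 0F) (ecol s j)
        ∷ orient s' tb (int (suc nx) 0F) (ecol s' j')
        ∷ orient s (int (suc nx) 2F) (int nx 1F) (third (ecol s j) (ecol s' ja))
        ∷ [])
  join : ∀ {nx s s' ta tb L} → Opp s s' →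
    Rewrite nx (dang s p1 ta ∷ dang s' m1 tb ∷ L) nx L (orient s ta tb (ecol s p1) ∷ [])
  Y-rule : ∀ {nx s s' j j' j'' ta tb L} → Opp s s' → YTab j j' j'' →
    Rewrite nx (dang s j ta ∷ dang s j' tb ∷ L)
      (suc nx) (dang s' j'' (int nx 2F) ∷ L)
      (orient s ta (int nx 0F) (ecol s j) ∷ orient s tb (int nx 1F) (ecol s j') ∷ [])
  there : ∀ {nx nx' x L L' es} → Rewrite nx L nx' L' es → Rewrite nx (x ∷ L) nx' (x ∷ L') es

data Run : ℕ → List Dang → ℕ → List GEdge → Set where
  stop : ∀ {nx} → Run nx [] nx []
  _▸_  : ∀ {nx nx' nF L L' es es'} →
    Rewrite nx L nx' L' es → Run nx' L' nF es' → Run nx L nF (es ++ es')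

infixr 5 _▸_

there* : ∀ {nx nx' L L' es} pre → Rewrite nx L nx' L' es →
  Rewrite nx (pre ++ L) nx' (pre ++ L') es
there* []        st = st
there* (_ ∷ pre) st = there (there* pre st)

step⇒rewrite : ∀ {S T} → Step S T →
  ∃[ es ] GState.done T ≡ GState.done S ++ es
        × Rewrite (GState.nxt S) (GState.dangl S) (GState.nxt T) (GState.dangl T) es
step⇒rewrite (hRule _ pre _ _ s _ _ _ _ _ _ h)   = _ , refl , there* pre (H-rule (negS-opp s) h)
step⇒rewrite (joinRule _ pre _ _ s _ _)          = _ , refl , there* pre (join (negS-opp s))
step⇒rewrite (yRule _ pre _ _ s _ _ _ _ _ y)     = _ , refl , there* pre (Y-rule (negS-opp s) y)

steps⇒run : ∀ {S T} → Star Step S T → GState.dangl T ≡ [] →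
  ∃[ es ] GState.done T ≡ GState.done S ++ es
        × Run (GState.nxt S) (GState.dangl S) (GState.nxt T) es
steps⇒run {S} ε refl = [] , sym (++-identityʳ (GState.done S)) , stop
steps⇒run {S} (st ◅ sts) e with step⇒rewrite st | steps⇒run sts e
... | es , p , rw | es' , p' , run =
  es ++ es' , trans p' (trans (cong (_++ es') p) (++-assoc (GState.done S) es es')) , rw ▸ run

-- Descents

data Adjacent (x y : Dang) : List Dang → Set where
  here  : ∀ {L} → Adjacent x y (x ∷ y ∷ L)
  there : ∀ {z L} → Adjacent x y L → Adjacent x y (z ∷ L)

join-forced-step : ∀ {nx nx' s s' ta tb L L' es} → Opp s s' →
  Adjacent (dang s p1 ta) (dang s' m1 tb) L → Rewrite nx L nx' L' es →
  (∃[ c ] orient s ta tb c ∈ es) ⊎ Adjacent (dang s p1 ta) (dang s' m1 tb) L'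
join-forced-step _  here (H-rule _ ())
join-forced-step o  here (join _)                   = inj₁ (_ , here refl)
join-forced-step () here (Y-rule _ y1m)
join-forced-step _  here (there (H-rule _ ()))
join-forced-step _  here (there (Y-rule _ ()))
join-forced-step _  here (there (there st))         = inj₂ here
join-forced-step _  (there here) (H-rule _ ())
join-forced-step _  (there here) (Y-rule _ ())
join-forced-step _  (there (there a)) (H-rule _ _)  = inj₂ (there (there a))
join-forced-step _  (there (there a)) (join _)      = inj₂ a
join-forced-step _  (there (there a)) (Y-rule _ _)  = inj₂ (there a)
join-forced-step o  (there a) (there st) with join-forced-step o a st
... | inj₁ e = inj₁ e
... | inj₂ b = inj₂ (there b)

-- A state 1 never reacts with its left neighbour, nor a state -1 with its right one.
join-forced : ∀ {nx nF s s' ta tb L es} → Opp s s' →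
  Adjacent (dang s p1 ta) (dang s' m1 tb) L → Run nx L nF es →
  ∃[ c ] orient s ta tb c ∈ es
join-forced o a (st ▸ run) with join-forced-step o a st
... | inj₁ (c , e) = c , ∈-++⁺ˡ e
... | inj₂ a' with join-forced o a' run
...   | c , e = c , ∈-++⁺ʳ _ e

Fork : Sgn → GEnd → GEnd → List GEdge → Set
Fork s ta tb es = ∃[ v ] (∃[ a ] ∃[ c ] orient s ta (int v a) c ∈ es)
                       × (∃[ b ] ∃[ c ] orient s tb (int v b) c ∈ es)

-- A descent is a pair of adjacent edges of equal sign to which a Y-rule applies. If one of the two
-- reacts with its outer neighbour first, the new vertex hangs an edge beside the other one, in
-- states (1, -1) and with opposite signs; the join forced there brings both edges to that vertex.
data Fate (s : Sgn) (ta tb : GEnd) (L : List Dang) (es : List GEdge) : Set where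
  forked   : Fork s ta tb es → Fate s ta tb L es
  waiting  : ∀ {j j' j''} → YTab j j' j'' → Adjacent (dang s j ta) (dang s j' tb) L → Fate s ta tb L es
  joinLeft  : ∀ {s' v b b' c} → Opp s s' → orient s tb (int v b) c ∈ es →
    Adjacent (dang s p1 ta) (dang s' m1 (int v b')) L → Fate s ta tb L es
  joinRight : ∀ {s' v a a' c} → Opp s' s → orient s ta (int v a) c ∈ es →
    Adjacent (dang s' p1 (int v a')) (dang s m1 tb) L → Fate s ta tb L es

fate-there : ∀ {s ta tb x L es} → Fate s ta tb L es → Fate s ta tb (x ∷ L) es
fate-there (forked f)        = forked f
fate-there (waiting y a)     = waiting y (there a)
fate-there (joinLeft o e a)  = joinLeft o e (there a)
fate-there (joinRight o e a) = joinRight o e (there a)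

Opp-sym : ∀ {s s'} → Opp s s' → Opp s' s
Opp-sym +- = -+
Opp-sym -+ = +-

fate : ∀ {nx nx' s j j' j'' ta tb L L' es} → YTab j j' j'' →
  Adjacent (dang s j ta) (dang s j' tb) L → Rewrite nx L nx' L' es → Fate s ta tb L' es
fate y here (H-rule () _)
fate y here (join ())
fate y here (Y-rule _ _) = forked (_ , (_ , _ , here refl) , (_ , _ , there (here refl)))
-- The right edge has state 0, and every rule taking it as left partner hangs a new state -1 beside
-- the remaining state 1.
fate y10 here (there (H-rule o h00)) = joinLeft o (here refl) here
fate y10 here (there (H-rule o h0m)) = joinLeft o (here refl) here
fate y10 here (there (Y-rule o y0m)) = joinLeft o (here refl) here
fate y here (there (there st)) = waiting y here
-- Mirror image: the left edge has state 0, and the rule leaves a state 1 beside the remaining -1.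
fate y0m (there here) (H-rule o h10) = joinRight o (there (here refl)) (there here)
fate y0m (there here) (H-rule o h00) = joinRight o (there (here refl)) (there here)
fate y0m (there here) (Y-rule o y10) = joinRight (Opp-sym o) (there (here refl)) here
fate y (there (there a)) (H-rule _ _) = waiting y (there (there a))
fate y (there (there a)) (join _)     = waiting y a
fate y (there (there a)) (Y-rule _ _) = waiting y (there a)
fate y (there a) (there st) = fate-there (fate y a st)

orient-opp : ∀ {s s'} → Opp s s' → ∀ x y c → orient s x y c ≡ orient s' y x c
orient-opp +- _ _ _ = refl
orient-opp -+ _ _ _ = refl

fork-++ʳ : ∀ {s ta tb es'} es → Fork s ta tb es' → Fork s ta tb (es ++ es')
fork-++ʳ es (v , (a , c , e) , (b , c' , e')) = v , (a , c , ∈-++⁺ʳ es e) , (b , c' , ∈-++⁺ʳ es e')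

-- The run ends with an empty string, so a descent cannot wait forever; if the two edges do not meet
-- directly, the forced join supplies the second prong.
descent⇒fork : ∀ {nx nF s j j' j'' ta tb L es} → YTab j j' j'' →
  Adjacent (dang s j ta) (dang s j' tb) L → Run nx L nF es → Fork s ta tb es
descent⇒fork y a (st ▸ run) with fate y a st
... | forked (v , (a , c , e) , (b , c' , e')) = v , (a , c , ∈-++⁺ˡ e) , (b , c' , ∈-++⁺ˡ e')
... | waiting y' a' = fork-++ʳ _ (descent⇒fork y' a' run)
... | joinLeft o e a' with join-forced o a' run
...   | c , e' = _ , (_ , c , ∈-++⁺ʳ _ e') , (_ , _ , ∈-++⁺ˡ e)
descent⇒fork y a (st ▸ run) | joinRight {v = v} {a' = a'} o e adj with join-forced o adj run
-- The forced join runs from the new vertex to `tb`; `orient-opp` reads it in the other direction.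
...   | c , e' = _ , (_ , _ , ∈-++⁺ˡ e) , (_ , c , ∈-++⁺ʳ _ (subst (_∈ _) (orient-opp o _ _ c) e'))

-- Colours

data Rainbow : Col → Col → Col → Set where
  m0p : Rainbow m1 z0 p1
  mp0 : Rainbow m1 p1 z0
  0mp : Rainbow z0 m1 p1
  0pm : Rainbow z0 p1 m1
  pm0 : Rainbow p1 m1 z0
  p0m : Rainbow p1 z0 m1

rainbow⇒third : ∀ {a b c} → Rainbow a b c → c ≡ third a b
rainbow⇒third m0p = refl
rainbow⇒third mp0 = refl
rainbow⇒third 0mp = refl
rainbow⇒third 0pm = refl
rainbow⇒third pm0 = refl
rainbow⇒third p0m = refl

third-rainbow : ∀ a b → a ≢ b → Rainbow a b (third a b)
third-rainbow m1 m1 p = contradiction refl p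
third-rainbow m1 z0 _ = m0p
third-rainbow m1 p1 _ = mp0
third-rainbow z0 m1 _ = 0mp
third-rainbow z0 z0 p = contradiction refl p
third-rainbow z0 p1 _ = 0pm
third-rainbow p1 m1 _ = pm0
third-rainbow p1 z0 _ = p0m
third-rainbow p1 p1 p = contradiction refl p

rainbow-≢ : ∀ {a b c} → Rainbow a b c → a ≢ b × a ≢ c × b ≢ c
rainbow-≢ m0p = (λ ()) , (λ ()) , (λ ())
rainbow-≢ mp0 = (λ ()) , (λ ()) , (λ ())
rainbow-≢ 0mp = (λ ()) , (λ ()) , (λ ())
rainbow-≢ 0pm = (λ ()) , (λ ()) , (λ ())
rainbow-≢ pm0 = (λ ()) , (λ ()) , (λ ())
rainbow-≢ p0m = (λ ()) , (λ ()) , (λ ())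

-- Weights

-- The two coordinates of the root order: one path dominates another when it is at least as large in
-- both.
data Fund : Set where
  ω₁ ω₂ : Fund

-- Up to a constant depending only on the sign, the coefficient of the i-th
-- simple root in the weight of an edge of the given sign and colour.
u : Fund → Sgn → Col → ℕ
u ω₁ plus  p1 = 1
u ω₁ plus  _  = 0
u ω₁ minus p1 = 0
u ω₁ minus _  = 1
u ω₂ plus  m1 = 0
u ω₂ plus  _  = 1
u ω₂ minus m1 = 1
u ω₂ minus _  = 0

u-opp : ∀ i {s s'} → Opp s s' → ∀ c → u i s c + u i s' c ≡ 1
u-opp ω₁ +- m1 = refl
u-opp ω₁ +- z0 = refl
u-opp ω₁ +- p1 = refl
u-opp ω₁ -+ m1 = refl
u-opp ω₁ -+ z0 = refl
u-opp ω₁ -+ p1 = refl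
u-opp ω₂ +- m1 = refl
u-opp ω₂ +- z0 = refl
u-opp ω₂ +- p1 = refl
u-opp ω₂ -+ m1 = refl
u-opp ω₂ -+ z0 = refl
u-opp ω₂ -+ p1 = refl

u≤1 : ∀ i s c → u i s c ≤ 1
u≤1 i plus  c = subst (u i plus c ≤_) (u-opp i +- c) (m≤m+n _ _)
u≤1 i minus c = subst (u i minus c ≤_) (u-opp i -+ c) (m≤m+n _ _)

u-top : ∀ i s → u i s (ecol s p1) ≡ 1
u-top ω₁ plus  = refl
u-top ω₁ minus = refl
u-top ω₂ plus  = refl
u-top ω₂ minus = refl

u-bottom : ∀ i s → u i s (ecol s m1) ≡ 0
u-bottom ω₁ plus  = refl
u-bottom ω₁ minus = refl
u-bottom ω₂ plus  = refl
u-bottom ω₂ minus = refl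

-- The additive constants in `u` do not cancel at a trivalent vertex. What is left over is twice the
-- constant of the sign less that of the opposite sign.
excess : Fund → Sgn → ℕ
excess ω₁ plus  = 0
excess ω₁ minus = 1
excess ω₂ plus  = 1
excess ω₂ minus = 0

-- The three weights of one sign sum to zero, so the total depends only on the constants in `u`.
u-rainbow : ∀ i s {a b c} → Rainbow a b c → u i s a + u i s b + u i s c ≡ excess i s + 1
u-rainbow ω₁ plus  m0p = refl
u-rainbow ω₁ plus  mp0 = refl
u-rainbow ω₁ plus  0mp = refl
u-rainbow ω₁ plus  0pm = refl
u-rainbow ω₁ plus  pm0 = refl
u-rainbow ω₁ plus  p0m = refl
u-rainbow ω₁ minus m0p = refl
u-rainbow ω₁ minus mp0 = refl
u-rainbow ω₁ minus 0mp = refl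
u-rainbow ω₁ minus 0pm = refl
u-rainbow ω₁ minus pm0 = refl
u-rainbow ω₁ minus p0m = refl
u-rainbow ω₂ plus  m0p = refl
u-rainbow ω₂ plus  mp0 = refl
u-rainbow ω₂ plus  0mp = refl
u-rainbow ω₂ plus  0pm = refl
u-rainbow ω₂ plus  pm0 = refl
u-rainbow ω₂ plus  p0m = refl
u-rainbow ω₂ minus m0p = refl
u-rainbow ω₂ minus mp0 = refl
u-rainbow ω₂ minus 0mp = refl
u-rainbow ω₂ minus 0pm = refl
u-rainbow ω₂ minus pm0 = refl
u-rainbow ω₂ minus p0m = refl

u-Y : ∀ i {s s' a b c} → Opp s s' → Rainbow a b c → u i s a + u i s b ≡ excess i s + u i s' c
u-Y i {s} {s'} {a} {b} {c} o r = +-cancelʳ-≡ (u i s c) _ _ (begin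
  u i s a + u i s b + u i s c         ≡⟨ u-rainbow i s r ⟩
  excess i s + 1                      ≡⟨ cong (excess i s +_) (u-opp i (Opp-sym o) c) ⟨
  excess i s + (u i s' c + u i s c)   ≡⟨ +-assoc (excess i s) _ _ ⟨
  excess i s + u i s' c + u i s c     ∎)
  where open ≡-Reasoning

-- Both vertices carry the horizontal colour `h`, so subtracting their balances cancels it. No
-- `excess` remains, since each side has one edge of either sign.
u-H : ∀ i {s s' a b c d h} → Opp s s' → Rainbow a c h → Rainbow b d h →
  u i s a + u i s' b ≡ u i s' c + u i s d
u-H i {s} {s'} {a} {b} {c} {d} {h} o r r' = +-cancelʳ-≡ (u i s c + u i s b) _ _ (begin
  u i s a + u i s' b + (u i s c + u i s b)
    ≡⟨ solve 4 (λ a b' c b → a :+ b' :+ (c :+ b) := (b :+ b') :+ (a :+ c)) refl (u i s a) (u i s' b) (u i s c) (u i s b) ⟩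
  (u i s b + u i s' b) + (u i s a + u i s c)
    ≡⟨ cong₂ _+_ (trans (u-opp i o b) (sym (u-opp i o c))) balance ⟩
  (u i s c + u i s' c) + (u i s b + u i s d)
    ≡⟨ solve 4 (λ c c' b d → (c :+ c') :+ (b :+ d) := c' :+ d :+ (c :+ b)) refl (u i s c) (u i s' c) (u i s b) (u i s d) ⟩
  u i s' c + u i s d + (u i s c + u i s b) ∎)
  where
    open ≡-Reasoning
    balance : u i s a + u i s c ≡ u i s b + u i s d
    balance = +-cancelʳ-≡ (u i s h) _ _ (trans (u-rainbow i s r) (sym (u-rainbow i s r')))

-- Colours in the growth rules

H-left : ∀ {s s' j j' ja jb} → Opp s s' → HTab j j' ja jb → ecol s j ≢ ecol s' ja
H-left +- h10 ()
H-left +- h00 ()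
H-left +- h0m ()
H-left -+ h10 ()
H-left -+ h00 ()
H-left -+ h0m ()

-- The rule computes the horizontal colour from the left vertex; the table makes the same colour fit
-- the right vertex too.
H-right : ∀ {s s' j j' ja jb} → Opp s s' → HTab j j' ja jb →
  Rainbow (ecol s' j') (ecol s jb) (third (ecol s j) (ecol s' ja))
H-right +- h10 = 0pm
H-right +- h00 = 0pm
H-right +- h0m = p0m
H-right -+ h10 = 0mp
H-right -+ h00 = 0mp
H-right -+ h0m = m0p

Y-rainbow : ∀ {s s' j j' j''} → Opp s s' → YTab j j' j'' → Rainbow (ecol s j) (ecol s j') (ecol s' j'')
Y-rainbow +- y10 = p0m
Y-rainbow +- y0m = 0mp
Y-rainbow +- y1m = pm0
Y-rainbow -+ y10 = m0p
Y-rainbow -+ y0m = 0pm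
Y-rainbow -+ y1m = mp0

-- Colourings are carried by the ends of edges, so that a dangling edge has a colour at its upper
-- end before its lower end exists; on a completed edge the two ends have to agree.
Compatible : (GEnd → Col) → GEdge → Set
Compatible γ g = γ (GEdge.gb g) ≡ γ (GEdge.gw g)

compatible-orient : ∀ γ s {x y c} → Compatible γ (orient s x y c) → γ x ≡ γ y
compatible-orient γ plus  e = e
compatible-orient γ minus e = sym e

Agrees : (GEnd → Col) → Dang → Set
Agrees γ (dang s j x) = γ x ≡ ecol s j

Tinted : (GEnd → Col) → GEdge → Set
Tinted γ g = (γ (GEdge.gb g) ≡ GEdge.gc g) × (γ (GEdge.gw g) ≡ GEdge.gc g)

tinted-orient : ∀ γ s {x y c} → Tinted γ (orient s x y c) → γ x ≡ c × γ y ≡ c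
tinted-orient γ plus  e       = e
tinted-orient γ minus (e , f) = f , e

orient-tinted : ∀ γ s {x y c} → γ x ≡ c → γ y ≡ c → Tinted γ (orient s x y c)
orient-tinted γ plus  e f = e , f
orient-tinted γ minus e f = f , e

ProperAt : (GEnd → Col) → ℕ → Set
ProperAt γ v = Rainbow (γ (int v 0F)) (γ (int v 1F)) (γ (int v 2F))

rainbow-cong : ∀ {a b c a' b' c'} → a ≡ a' → b ≡ b' → c ≡ c' → Rainbow a' b' c' → Rainbow a b c
rainbow-cong refl refl refl r = r

rainbow-swap : ∀ {a b c} → Rainbow a b c → Rainbow a c b
rainbow-swap m0p = mp0
rainbow-swap mp0 = m0p
rainbow-swap 0mp = 0pm
rainbow-swap 0pm = 0mp
rainbow-swap pm0 = p0m
rainbow-swap p0m = pm0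

-- The Khovanov–Kuperberg colouring

module _ (γ : GEnd → Col) where

  -- The edges consumed by a step are among those it completes, so their recorded colours settle the
  -- string before it; the argument runs backwards from the empty string.
  rewrite-agrees : ∀ {nx nx' L L' es} → Rewrite nx L nx' L' es →
    All (Tinted γ) es → All (Agrees γ) L' → All (Agrees γ) L
  rewrite-agrees (H-rule {s = s} {s'} o h) (p ∷ q ∷ r ∷ []) (_ ∷ _ ∷ as) =
    proj₁ (tinted-orient γ s p) ∷ proj₁ (tinted-orient γ s' q) ∷ as
  rewrite-agrees (join {s = s} o) (p ∷ []) as =
    proj₁ (tinted-orient γ s p) ∷ trans (proj₂ (tinted-orient γ s p)) (flip o) ∷ as
    where
      flip : ∀ {s s'} → Opp s s' → ecol s p1 ≡ ecol s' m1
      flip +- = refl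
      flip -+ = refl
  rewrite-agrees (Y-rule {s = s} o y) (p ∷ q ∷ []) (_ ∷ as) =
    proj₁ (tinted-orient γ s p) ∷ proj₁ (tinted-orient γ s q) ∷ as
  rewrite-agrees (there st) ts (a ∷ as) = a ∷ rewrite-agrees st ts as

  tinted⇒agrees : ∀ {nx nF L es} → Run nx L nF es → All (Tinted γ) es → All (Agrees γ) L
  tinted⇒agrees stop ts = []
  tinted⇒agrees (_▸_ {es = es} st run) ts =
    rewrite-agrees st (++⁻ˡ es ts) (tinted⇒agrees run (++⁻ʳ es ts))

  rewrite-proper : ∀ {nx nx' L L' es} → Rewrite nx L nx' L' es →
    All (Tinted γ) es → All (Agrees γ) L' → ∀ v → nx ≤ v → v < nx' → ProperAt γ v
  rewrite-proper {nx} (H-rule {s = s} {s'} o h) (p ∷ q ∷ r ∷ []) (a ∷ b ∷ _) v nx≤v v<2+nx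
    with m≤n⇒m<n∨m≡n nx≤v
  ... | inj₂ refl = rainbow-cong (proj₂ (tinted-orient γ s p)) (proj₂ (tinted-orient γ s r)) a
                      (rainbow-swap (third-rainbow _ _ (H-left o h)))
  ... | inj₁ nx<v with ≤-antisym nx<v (≤-pred v<2+nx)
  ...   | refl = rainbow-cong (proj₂ (tinted-orient γ s' q)) b (proj₁ (tinted-orient γ s r)) (H-right o h)
  rewrite-proper (join o) ts as v nx≤v v<nx = contradiction v<nx (≤⇒≯ nx≤v)
  rewrite-proper (Y-rule {s = s} o y) (p ∷ q ∷ []) (a ∷ _) v nx≤v v<1+nx
    with ≤-antisym nx≤v (≤-pred v<1+nx)
  ... | refl = rainbow-cong (proj₂ (tinted-orient γ s p)) (proj₂ (tinted-orient γ s q)) a (Y-rainbow o y)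
  rewrite-proper (there st) ts (_ ∷ as) = rewrite-proper st ts as

  -- Vertex numbers grow along the run, so `v` belongs to the one step whose range of new numbers
  -- contains it.
  tinted⇒proper : ∀ {nx nF L es} → Run nx L nF es → All (Tinted γ) es →
    ∀ v → nx ≤ v → v < nF → ProperAt γ v
  tinted⇒proper stop ts v nx≤v v<nx = contradiction v<nx (≤⇒≯ nx≤v)
  tinted⇒proper (_▸_ {nx' = nx'} {es = es} st run) ts v nx≤v v<nF with <-≤-connex v nx'
  ... | inj₁ v<nx' = rewrite-proper st (++⁻ˡ es ts) (tinted⇒agrees run (++⁻ʳ es ts)) v nx≤v v<nx'
  ... | inj₂ nx'≤v = tinted⇒proper run (++⁻ʳ es ts) v nx'≤v v<nF

-- Comparison with an arbitrary proper colouring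

-- Either u i s (ecol s z0) is 1, or u i s' (ecol s' m1) is 0 as well and u i s c ≤ u i s' c'.
h00-middle : ∀ i {s s'} → Opp s s' → ∀ {a b} c c' → c ≢ c' → b ≤ a →
  b + u i s' c' ≤ a + u i s' (ecol s' m1) → b + u i s c ≤ a + u i s (ecol s z0)
h00-middle ω₁ +- m1 c' _ b≤a _ = +-monoˡ-≤ 0 b≤a
h00-middle ω₁ +- z0 c' _ b≤a _ = +-monoˡ-≤ 0 b≤a
h00-middle ω₁ +- p1 m1 _ _ q = q
h00-middle ω₁ +- p1 z0 _ _ q = q
h00-middle ω₁ +- p1 p1 p _ _ = contradiction refl p
h00-middle ω₁ -+ c  c' _ b≤a _ = +-mono-≤ b≤a (u≤1 ω₁ minus c)
h00-middle ω₂ +- c  c' _ b≤a _ = +-mono-≤ b≤a (u≤1 ω₂ plus c)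
h00-middle ω₂ -+ z0 c' _ b≤a _ = +-monoˡ-≤ 0 b≤a
h00-middle ω₂ -+ p1 c' _ b≤a _ = +-monoˡ-≤ 0 b≤a
h00-middle ω₂ -+ m1 m1 p _ _ = contradiction refl p
h00-middle ω₂ -+ m1 z0 _ _ q = q
h00-middle ω₂ -+ m1 p1 _ _ q = q

top-middle : ∀ i s {a b} c → b ≤ a → b + u i s c ≤ a + u i s (ecol s p1)
top-middle i s c b≤a = +-mono-≤ b≤a (subst (u i s c ≤_) (sym (u-top i s)) (u≤1 i s c))

-- State -1 takes the smallest possible step, so an inequality after that step passes back to the
-- point before it.
bottom-middle : ∀ i s {a b} c → b + u i s c ≤ a + u i s (ecol s m1) → b ≤ a
bottom-middle i s {a} {b} c q =
  ≤-trans (m≤m+n b _) (≤-trans q (≤-reflexive (trans (cong (a +_) (u-bottom i s)) (+-identityʳ a))))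

module _ (γ : GEnd → Col) where

  -- Here `a` is the coordinate reached by the path of the states in the string and `b` that of the
  -- path of `γ`; the inequality is required at every point.
  Dom : Fund → ℕ → ℕ → List Dang → Set
  Dom i a b []               = b ≤ a
  Dom i a b (dang s j x ∷ L) = b ≤ a × Dom i (a + u i s (ecol s j)) (b + u i s (γ x)) L

  dom-head : ∀ i {a b} L → Dom i a b L → b ≤ a
  dom-head i []      p       = p
  dom-head i (_ ∷ L) (p , _) = p

  -- Needed because joins and Y-rules preserve the path beyond the segment only up to a constant
  -- common to both colourings.
  dom-shift : ∀ i e {a b} L → Dom i a b L → Dom i (e + a) (e + b) L
  dom-shift i e []               p       = +-monoʳ-≤ e p
  dom-shift i e {a} {b} (dang s j x ∷ L) (p , q) = +-monoʳ-≤ e p ,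
    subst₂ (λ a b → Dom i a b L) (sym (+-assoc e a _)) (sym (+-assoc e b _)) (dom-shift i e L q)

module _ (γ : GEnd → Col) (proper : ∀ v → ProperAt γ v) where

  dom-rewrite : ∀ i {nx nx' L L' es} a b → Rewrite nx L nx' L' es →
    All (Compatible γ) es → Dom γ i a b L' → Dom γ i a b L
  dom-rewrite i {nx} a b (H-rule {s = s} {s'} {j} {j'} {ja} {jb} {ta} {tb} {L} o h) (p ∷ q ∷ r ∷ []) (d , d' , D) =
    d , middle h (dom-head γ i L D') , D'
    where
      left : Rainbow (γ ta) (γ (int nx 2F)) (γ (int nx 1F))
      left = rainbow-swap (rainbow-cong (compatible-orient γ s p) refl refl (proper nx))
      right : Rainbow (γ tb) (γ (int (suc nx) 1F)) (γ (int nx 1F))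
      right = rainbow-cong (compatible-orient γ s' q) refl (sym (compatible-orient γ s r)) (proper (suc nx))
      regroup : ∀ a {x y z w} → x + y ≡ z + w → a + z + w ≡ a + x + y
      regroup a {x} {y} {z} {w} e = trans (+-assoc a z w) (trans (cong (a +_) (sym e)) (sym (+-assoc a x y)))
      D' : Dom γ i (a + u i s (ecol s j) + u i s' (ecol s' j')) (b + u i s (γ ta) + u i s' (γ tb)) L
      D' = subst₂ (λ a b → Dom γ i a b L)
             (regroup a (u-H i o (third-rainbow _ _ (H-left o h)) (H-right o h)))
             (regroup b (u-H i o left right)) D
      -- For (1,0) the left edge takes the largest step and for (0,-1) the right edge takes the
      -- smallest; only (0,0) uses the inequality `d'` at the point inside the segment after the
      -- rule.
      middle : HTab j j' ja jb → b + u i s (γ ta) + u i s' (γ tb) ≤ a + u i s (ecol s j) + u i s' (ecol s' j') →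
        b + u i s (γ ta) ≤ a + u i s (ecol s j)
      middle h10 _ = top-middle i s (γ ta) d
      middle h00 _ = h00-middle i o (γ ta) (γ (int nx 2F)) (proj₁ (rainbow-≢ left)) d d'
      middle h0m q = bottom-middle i s' (γ tb) q
  dom-rewrite i a b (join {s = s} {s'} {ta} {tb} {L} o) (p ∷ []) D =
    d , top-middle i s (γ ta) d ,
    -- The joined pair adds 1 to each path, whatever colour `γ` gives the edge.
    subst₂ (λ a b → Dom γ i a b L) (regroup a (total o)) (regroup b total') (dom-shift γ i 1 L D)
    where
      d = dom-head γ i L D
      total : ∀ {s s'} → Opp s s' → u i s (ecol s p1) + u i s' (ecol s' m1) ≡ 1
      total {s} {s'} _ = cong₂ _+_ (u-top i s) (u-bottom i s')
      total' : u i s (γ ta) + u i s' (γ tb) ≡ 1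
      total' = trans (cong (λ c → u i s (γ ta) + u i s' c) (sym (compatible-orient γ s p))) (u-opp i o (γ ta))
      regroup : ∀ a {x y} → x + y ≡ 1 → 1 + a ≡ a + x + y
      regroup a {x} {y} e = trans (+-comm 1 a) (trans (cong (a +_) (sym e)) (sym (+-assoc a x y)))
  dom-rewrite i {nx} a b (Y-rule {s = s} {s'} {j} {j'} {j''} {ta} {tb} {L} o y) (p ∷ q ∷ []) (d , D) =
    d , middle y (dom-head γ i L D') , D'
    where
      regroup : ∀ a {x y z} → x + y ≡ excess i s + z → excess i s + (a + z) ≡ a + x + y
      regroup a {x} {y} {z} eq = trans
        (solve 3 (λ e a z → e :+ (a :+ z) := a :+ (e :+ z)) refl (excess i s) a z)
        (trans (cong (a +_) (sym eq)) (sym (+-assoc a x y)))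
      D' : Dom γ i (a + u i s (ecol s j) + u i s (ecol s j')) (b + u i s (γ ta) + u i s (γ tb)) L
      D' = subst₂ (λ a b → Dom γ i a b L)
             (regroup a (u-Y i o (Y-rainbow o y)))
             (regroup b (u-Y i o (rainbow-cong (compatible-orient γ s p) (compatible-orient γ s q) refl (proper nx))))
             (dom-shift γ i (excess i s) L D)
      middle : YTab j j' j'' → b + u i s (γ ta) + u i s (γ tb) ≤ a + u i s (ecol s j) + u i s (ecol s j') →
        b + u i s (γ ta) ≤ a + u i s (ecol s j)
      middle y10 _ = top-middle i s (γ ta) d
      middle y0m q = bottom-middle i s (γ tb) q
      middle y1m _ = top-middle i s (γ ta) d
  dom-rewrite i a b (there {x = dang s j x} st) ps (d , D) = d , dom-rewrite i _ _ st ps D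

  dom-run : ∀ i {nx nF L es} → Run nx L nF es → All (Compatible γ) es → Dom γ i 0 0 L
  dom-run i stop ps = z≤n
  dom-run i (_▸_ {es = es} st run) ps = dom-rewrite i 0 0 st (++⁻ˡ es ps) (dom-run i run (++⁻ʳ es ps))

  -- Two agreeing edges determine the third at a Y-vertex, and an H-rule whose upper edges have
  -- distinct colours forces the horizontal colour. Rule (0,0) leaves two choices; dominance at the
  -- middle point, with both paths level before the segment, rejects one.
  rewrite-rigid : ∀ {nx nx' L L' es} a → Rewrite nx L nx' L' es → All (Compatible γ) es →
    Dom γ ω₁ a a L' → All (Agrees γ) L → All (Agrees γ) L' × All (Tinted γ) es
  rewrite-rigid {nx} a (H-rule {s = s} {s'} {j} {j'} {ja} {jb} {ta} {tb} o h) (p ∷ q ∷ r ∷ []) (_ , d , _) (ea ∷ eb ∷ es) =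
    (γc ∷ γd ∷ es) ,
    orient-tinted γ s ea (trans (sym pe) ea) ∷ orient-tinted γ s' eb (trans (sym qe) eb)
      ∷ orient-tinted γ s (trans re γh) γh ∷ []
    where
      pe = compatible-orient γ s p
      qe = compatible-orient γ s' q
      re = compatible-orient γ s r
      -- Both vertices are written with the horizontal colour in second place, so that matching one
      -- `Rainbow` fixes it in the other.
      left : Rainbow (ecol s j) (γ (int nx 1F)) (γ (int nx 2F))
      left = rainbow-cong (trans (sym ea) pe) refl refl (proper nx)
      right : Rainbow (ecol s' j') (γ (int nx 1F)) (γ (int (suc nx) 1F))
      right = rainbow-swap (rainbow-cong (trans (sym eb) qe) refl (sym re) (proper (suc nx)))
      solution : ∀ {s s' j j' ja jb h c d} → Opp s s' → HTab j j' ja jb →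
        Rainbow (ecol s j) h c → Rainbow (ecol s' j') h d →
        a + u ω₁ s' c ≤ a + u ω₁ s' (ecol s' ja) → c ≡ ecol s' ja × d ≡ ecol s jb
      solution +- h10 pm0 0mp _ = refl , refl
      solution -+ h10 mp0 0pm _ = refl , refl
      solution +- h0m 0mp pm0 _ = refl , refl
      solution -+ h0m 0pm mp0 _ = refl , refl
      solution +- h00 0mp 0mp _ = refl , refl
      -- The other choice raises the path of `γ` by 1 in coordinate `ω₁`, where the KK-path does not
      -- rise.
      solution +- h00 0pm 0pm q = contradiction (+-cancelˡ-≤ a _ _ q) λ ()
      solution -+ h00 0pm 0pm _ = refl , refl
      solution -+ h00 0mp 0mp q = contradiction (+-cancelˡ-≤ a _ _ q) λ ()
      γc = proj₁ (solution o h left right d)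
      γd = proj₂ (solution o h left right d)
      γh : γ (int nx 1F) ≡ third (ecol s j) (ecol s' ja)
      γh = trans (rainbow⇒third (rainbow-swap left)) (cong (third (ecol s j)) γc)
  rewrite-rigid a (join {s = s} o) (p ∷ []) D (ea ∷ eb ∷ es) =
    es , orient-tinted γ s ea (trans (sym (compatible-orient γ s p)) ea) ∷ []
  rewrite-rigid a (Y-rule {s = s} o y) (p ∷ q ∷ []) D (ea ∷ eb ∷ es) =
    (trans (rainbow⇒third (proper _))
       (trans (cong₂ third ea' eb') (sym (rainbow⇒third (Y-rainbow o y)))) ∷ es) ,
    orient-tinted γ s ea ea' ∷ orient-tinted γ s eb eb' ∷ []
    where
      ea' = trans (sym (compatible-orient γ s p)) ea
      eb' = trans (sym (compatible-orient γ s q)) eb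
  rewrite-rigid a (there {x = dang s j x} {L' = L'} st) ps (_ , D) (e ∷ es)
    with rewrite-rigid (a + u ω₁ s (ecol s j)) st ps
           (subst (λ c → Dom γ ω₁ (a + u ω₁ s (ecol s j)) (a + u ω₁ s c) L') e D) es
  ... | es' , ts = e ∷ es' , ts

  run-rigid : ∀ {nx nF L es} → Run nx L nF es → All (Compatible γ) es →
    All (Agrees γ) L → All (Tinted γ) es
  run-rigid stop ps as = []
  run-rigid (_▸_ {es = es} st run) ps as
    with rewrite-rigid 0 st (++⁻ˡ es ps) (dom-run ω₁ run (++⁻ʳ es ps)) as
  ... | as' , ts = ++⁺ ts (run-rigid run (++⁻ʳ es ps) as')

-- Finite sums

only : Bool → ℕ → ℕ
only b x = if b then x else 0

sum-zero : ∀ {n} {f : Fin n → ℕ} → (∀ i → f i ≡ 0) → sum f ≡ 0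
sum-zero {n} e = trans (sum-cong-≗ e) (sum-replicate-zero n)

sum-single : ∀ {n} (f : Fin n → ℕ) i → (∀ i' → i' ≢ i → f i' ≡ 0) → sum f ≡ f i
sum-single f zero    e = trans (cong (f zero +_) (sum-zero λ i → e (suc i) λ ())) (+-identityʳ _)
sum-single f (suc i) e = cong₂ _+_ (e zero λ ())
  (sum-single (f ∘ suc) i λ i' i'≢i → e (suc i') λ { refl → i'≢i refl })

sum-split : ∀ {n} {h : Fin n → ℕ} f g → (∀ i → h i ≡ f i + g i) → sum h ≡ sum f + sum g
sum-split f g e = trans (sum-cong-≗ e) (∑-distrib-+ f g)

sum-mono-≤ : ∀ {n} {f g : Fin n → ℕ} → (∀ i → f i ≤ g i) → sum f ≤ sum g
sum-mono-≤ {zero}  f≤g = z≤n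
sum-mono-≤ {suc n} f≤g = +-mono-≤ (f≤g zero) (sum-mono-≤ (f≤g ∘ suc))

sum-mono-< : ∀ {n} {f g : Fin n → ℕ} → (∀ i → f i ≤ g i) → ∀ i → f i < g i → sum f < sum g
sum-mono-< f≤g zero    p = +-mono-<-≤ p (sum-mono-≤ (f≤g ∘ suc))
sum-mono-< f≤g (suc i) p = +-mono-≤-< (f≤g zero) (sum-mono-< (f≤g ∘ suc) i p)

countB-tabulate : ∀ {A : Set} {n} (p : A → Bool) (f : Fin n → A) →
  countB p (tabulate f) ≡ sum (λ i → only (p (f i)) 1)
countB-tabulate {n = zero}  p f = refl
countB-tabulate {n = suc n} p f = cong (only (p (f zero)) 1 +_) (countB-tabulate p (f ∘ suc))

only-+ : ∀ b x y → only b (x + y) ≡ only b x + only b y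
only-+ true  x y = refl
only-+ false x y = refl

only-∧ : ∀ b c → only (b ∧ c) 1 ≡ only b (only c 1)
only-∧ true  c = refl
only-∧ false c = refl

only-false : ∀ {b} x → b ≢ true → only b x ≡ 0
only-false {true}  x p = contradiction refl p
only-false {false} x p = refl

-- Both sides equal the sum of `g e` over the pairs (e, t) with `Q t` and `f t ≡ e`, taken in the
-- two orders of summation.
sum-reindex : ∀ {m n} (P : Fin m → Bool) (Q : Fin n → Bool) (f : Fin n → Fin m) (g : Fin m → ℕ) →
  (∀ t → Q t ≡ true → P (f t) ≡ true) →
  (∀ e → P e ≡ true → ∃[ t ] Q t ≡ true × f t ≡ e) →
  (∀ t t' → Q t ≡ true → Q t' ≡ true → f t ≡ f t' → t ≡ t') →
  sum (λ e → only (P e) (g e)) ≡ sum (λ t → only (Q t) (g (f t)))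
sum-reindex P Q f g into onto inj = begin
  sum (λ e → only (P e) (g e))                           ≡⟨ sum-cong-≗ expand ⟩
  sum (λ e → sum (λ t → only (Q t) (pick t e)))          ≡⟨ ∑-comm (λ e t → only (Q t) (pick t e)) ⟩
  sum (λ t → sum (λ e → only (Q t) (pick t e)))          ≡⟨ sum-cong-≗ collapse ⟩
  sum (λ t → only (Q t) (g (f t)))                       ∎
  where
    open ≡-Reasoning
    pick : ∀ t e → ℕ
    pick t e = only ⌊ f t ≟ e ⌋ᵇ (g e)
    pick-≡ : ∀ t → pick t (f t) ≡ g (f t)
    pick-≡ t with f t ≟ f t
    ... | yes _ = refl
    ... | no ne = contradiction refl ne
    pick-≢ : ∀ t e → f t ≢ e → pick t e ≡ 0
    pick-≢ t e ne with f t ≟ e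
    ... | yes eq = contradiction eq ne
    ... | no _   = refl
    only-zero : ∀ b {x} → x ≡ 0 → only b x ≡ 0
    only-zero true  p = p
    only-zero false p = refl
    collapse : ∀ t → sum (λ e → only (Q t) (pick t e)) ≡ only (Q t) (g (f t))
    collapse t = trans
      (sum-single _ (f t) λ e ne → only-zero (Q t) (pick-≢ t e (ne ∘ sym)))
      (cong (only (Q t)) (pick-≡ t))
    expand : ∀ e → only (P e) (g e) ≡ sum (λ t → only (Q t) (pick t e))
    expand e with P e in Pe
    ... | true  = sym (step (onto e Pe))
      where
        step : ∃[ t ] Q t ≡ true × f t ≡ e → sum (λ t → only (Q t) (pick t e)) ≡ g e
        step (t , Qt , refl) = trans
          (sum-single _ t others)
          (trans (cong (λ b → only b (pick t (f t))) Qt) (pick-≡ t))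
          where
            others : ∀ t' → t' ≢ t → only (Q t') (pick t' (f t)) ≡ 0
            others t' ne with Q t' in Qt'
            ... | true  = pick-≢ t' (f t) (ne ∘ inj t' t Qt' Qt)
            ... | false = refl
    ... | false = sym (sum-zero others)
      where
        others : ∀ t → only (Q t) (pick t e) ≡ 0
        others t with Q t in Qt
        ... | false = refl
        ... | true  = pick-≢ t e λ { refl → contradiction (trans (sym (into t Qt)) Pe) λ () }

-- Monomials

flat : ∀ {n} → Mono n → List ℕ
flat {zero}  μ = []
flat {suc n} μ = μ zero 0F ∷ μ zero 1F ∷ μ zero 2F ∷ flat (μ ∘ suc)

flatten-flat : ∀ {n} (μ : Mono n) → flatten μ ≡ flat μ
flatten-flat {n} μ = trans (cong concat (map-tabulate {n = n} id _)) (go μ)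
  where
    go : ∀ {m} (ν : Mono m) → concat (tabulate (λ i → map (ν i) (allFin 3))) ≡ flat ν
    go {zero}  ν = refl
    go {suc m} ν = cong (λ L → ν zero 0F ∷ ν zero 1F ∷ ν zero 2F ∷ L) (go (ν ∘ suc))

flat-cong : ∀ {n} {μ ν : Mono n} → (∀ k r → μ k r ≡ ν k r) → flat μ ≡ flat ν
flat-cong {zero}  e = refl
flat-cong {suc n} e =
  cong₂ _∷_ (e zero 0F) (cong₂ _∷_ (e zero 1F) (cong₂ _∷_ (e zero 2F) (flat-cong (e ∘ suc))))

flat-injective : ∀ {n} {μ ν : Mono n} → flat μ ≡ flat ν → ∀ k r → μ k r ≡ ν k r
flat-injective {suc n} e zero 0F = cong (λ { (x ∷ _) → x ; [] → 0 }) e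
flat-injective {suc n} e zero 1F = cong (λ { (_ ∷ x ∷ _) → x ; _ → 0 }) e
flat-injective {suc n} e zero 2F = cong (λ { (_ ∷ _ ∷ x ∷ _) → x ; _ → 0 }) e
flat-injective {suc n} e (suc k) r = flat-injective (cong (λ { (_ ∷ _ ∷ _ ∷ L) → L ; _ → [] }) e) k r

degree : ∀ {n} → Mono n → Fin n → ℕ
degree μ k = μ k 0F + μ k 1F + μ k 2F

sum-flat-cong : ∀ {n} {μ ν : Mono n} → (∀ k → degree μ k ≡ degree ν k) → sumℕ (flat μ) ≡ sumℕ (flat ν)
sum-flat-cong {zero}  e = refl
sum-flat-cong {suc n} {μ} {ν} e = begin
  μ zero 0F + (μ zero 1F + (μ zero 2F + sumℕ (flat (μ ∘ suc)))) ≡⟨ assoc³ (μ zero 0F) _ _ _ ⟩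
  degree μ zero + sumℕ (flat (μ ∘ suc)) ≡⟨ cong₂ _+_ (e zero) (sum-flat-cong (e ∘ suc)) ⟩
  degree ν zero + sumℕ (flat (ν ∘ suc)) ≡⟨ assoc³ (ν zero 0F) _ _ _ ⟨
  ν zero 0F + (ν zero 1F + (ν zero 2F + sumℕ (flat (ν ∘ suc)))) ∎
  where
    open ≡-Reasoning
    assoc³ : ∀ a b c d → a + (b + (c + d)) ≡ a + b + c + d
    assoc³ a b c d = trans (sym (+-assoc a b (c + d))) (sym (+-assoc (a + b) c d))

LexLess : (f g : Fin 3 → ℕ) → Set
LexLess f g = f 0F < g 0F ⊎ (f 0F ≡ g 0F × (f 1F < g 1F ⊎ (f 1F ≡ g 1F × f 2F < g 2F)))

-- The tie-breaking comparison of the monomial order, regrouped by boundary vertex: `k` is the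
-- vertex of the first differing exponent. The smaller exponent there belongs to the larger
-- monomial.
FirstLess : ∀ {n} → Mono n → Mono n → Set
FirstLess μ ν = ∃[ k ] (∀ k' → toℕ k' < toℕ k → ∀ r → μ k' r ≡ ν k' r) × LexLess (μ k) (ν k)

revGt⇒firstLess : ∀ {n} {μ ν : Mono n} → RevGt (flat μ) (flat ν) → FirstLess μ ν
revGt⇒firstLess {suc n} (inj₁ p) = zero , (λ _ ()) , inj₁ p
revGt⇒firstLess {suc n} (inj₂ (e , inj₁ p)) = zero , (λ _ ()) , inj₂ (e , inj₁ p)
revGt⇒firstLess {suc n} (inj₂ (e , inj₂ (e' , inj₁ p))) = zero , (λ _ ()) , inj₂ (e , inj₂ (e' , p))
revGt⇒firstLess {suc n} {μ} {ν} (inj₂ (e , inj₂ (e' , inj₂ (e'' , p))))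
  with k , same , less ← revGt⇒firstLess {n} {μ ∘ suc} {ν ∘ suc} p = suc k , same' , less
  where
    same' : ∀ k' → toℕ k' < suc (toℕ k) → ∀ r → μ k' r ≡ ν k' r
    same' zero    _       0F = e
    same' zero    _       1F = e'
    same' zero    _       2F = e''
    same' (suc k') (s≤s q) = same k' q

eqL-sound : ∀ as bs → eqL as bs ≡ true → as ≡ bs
eqL-sound []       []       _ = refl
eqL-sound (a ∷ as) (b ∷ bs) e with a ≡ᵇ b in eq
... | true = cong₂ _∷_ (≡ᵇ⇒≡ a b (Equivalence.from T-≡ eq)) (eqL-sound as bs e)

≡ᵇ-refl : ∀ n → (n ≡ᵇ n) ≡ true
≡ᵇ-refl n = Equivalence.to T-≡ (≡⇒≡ᵇ n n refl)

eqL-refl : ∀ as → eqL as as ≡ true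
eqL-refl []       = refl
eqL-refl (a ∷ as) rewrite ≡ᵇ-refl a = eqL-refl as

-- Boundary colours and monomials

==C-sound : ∀ a b → (a ==C b) ≡ true → a ≡ b
==C-sound m1 m1 _ = refl
==C-sound z0 z0 _ = refl
==C-sound p1 p1 _ = refl

==C-refl : ∀ a → (a ==C a) ≡ true
==C-refl m1 = refl
==C-refl z0 = refl
==C-refl p1 = refl

_≟C_ : (a b : Col) → Dec (a ≡ b)
a ≟C b with a ==C b in eq
... | true  = yes (==C-sound a b eq)
... | false = no λ { refl → contradiction (trans (sym (==C-refl a)) eq) λ () }

sgnOf : VColor → Sgn
sgnOf black = plus
sgnOf white = minus

varIndex : VColor → Col → Fin 3
varIndex black m1 = 0F
varIndex black z0 = 1F
varIndex black p1 = 2F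
varIndex white p1 = 0F
varIndex white z0 = 1F
varIndex white m1 = 2F

varCol-varIndex : ∀ b c → varCol b (varIndex b c) ≡ c
varCol-varIndex black m1 = refl
varCol-varIndex black z0 = refl
varCol-varIndex black p1 = refl
varCol-varIndex white m1 = refl
varCol-varIndex white z0 = refl
varCol-varIndex white p1 = refl

u-injective : ∀ s c c' → (∀ i → u i s c ≡ u i s c') → c ≡ c'
u-injective s     m1 m1 e = refl
u-injective plus  m1 z0 e = contradiction (e ω₂) λ ()
u-injective minus m1 z0 e = contradiction (e ω₂) λ ()
u-injective plus  m1 p1 e = contradiction (e ω₂) λ ()
u-injective minus m1 p1 e = contradiction (e ω₂) λ ()
u-injective plus  z0 m1 e = contradiction (e ω₂) λ ()
u-injective minus z0 m1 e = contradiction (e ω₂) λ ()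
u-injective s     z0 z0 e = refl
u-injective plus  z0 p1 e = contradiction (e ω₁) λ ()
u-injective minus z0 p1 e = contradiction (e ω₁) λ ()
u-injective plus  p1 m1 e = contradiction (e ω₂) λ ()
u-injective minus p1 m1 e = contradiction (e ω₂) λ ()
u-injective plus  p1 z0 e = contradiction (e ω₁) λ ()
u-injective minus p1 z0 e = contradiction (e ω₁) λ ()
u-injective s     p1 p1 e = refl

-- The link between weights and the monomial order: `lowest` is 0 exactly on the first variable of a
-- vertex and `highest` is 1 exactly on the last. Listing the `y` variables in reverse makes this
-- hold at white vertices as well.
lowest highest : VColor → Fund
lowest  black = ω₂
lowest  white = ω₁
highest black = ω₁
highest white = ω₂

lowest-or-highest : ∀ b i → i ≡ lowest b ⊎ i ≡ highest b
lowest-or-highest black ω₁ = inj₂ refl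
lowest-or-highest black ω₂ = inj₁ refl
lowest-or-highest white ω₁ = inj₁ refl
lowest-or-highest white ω₂ = inj₂ refl

u-lowest : ∀ b c → only (c ==C varCol b 0F) 1 + u (lowest b) (sgnOf b) c ≡ 1
u-lowest black m1 = refl
u-lowest black z0 = refl
u-lowest black p1 = refl
u-lowest white m1 = refl
u-lowest white z0 = refl
u-lowest white p1 = refl

u-highest : ∀ b c → u (highest b) (sgnOf b) c ≡ only (c ==C varCol b 2F) 1
u-highest black m1 = refl
u-highest black z0 = refl
u-highest black p1 = refl
u-highest white m1 = refl
u-highest white z0 = refl
u-highest white p1 = refl

varCol-total : ∀ b c →
  only (c ==C varCol b 0F) 1 + only (c ==C varCol b 1F) 1 + only (c ==C varCol b 2F) 1 ≡ 1
varCol-total black m1 = refl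
varCol-total black z0 = refl
varCol-total black p1 = refl
varCol-total white m1 = refl
varCol-total white z0 = refl
varCol-total white p1 = refl

only-<ᵇ-suc : ∀ x m w → only (x <ᵇ suc m) w ≡ only (x <ᵇ m) w + only (x ≡ᵇ m) w
only-<ᵇ-suc zero    zero    w = refl
only-<ᵇ-suc zero    (suc m) w = sym (+-identityʳ w)
only-<ᵇ-suc (suc x) zero    w = refl
only-<ᵇ-suc (suc x) (suc m) w = only-<ᵇ-suc x m w

-- Initial segments as predicates, so that one form of dominance serves both for cutting after a
-- boundary vertex and for cutting after a single edge end.
PrefixClosed : ∀ {N} → (Fin N → Bool) → Set
PrefixClosed Q = ∀ t t' → toℕ t ≤ toℕ t' → Q t' ≡ true → Q t ≡ true

<ᵇ-sound : ∀ m n → (m <ᵇ n) ≡ true → m < n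
<ᵇ-sound m n e = <ᵇ⇒< m n (Equivalence.from T-≡ e)

<ᵇ-complete : ∀ {m n} → m < n → (m <ᵇ n) ≡ true
<ᵇ-complete p = Equivalence.to T-≡ (<⇒<ᵇ p)

module Boundary {n N} (bcol : Fin n → VColor) (pos : Fin N → Fin n) where

  sgn : Fin N → Sgn
  sgn t = sgnOf (bcol (pos t))

  at : Fin n → Fin N → Bool
  at k t = toℕ (pos t) ≡ᵇ toℕ k

  at-sound : ∀ {k} t → at k t ≡ true → pos t ≡ k
  at-sound {k} t e = toℕ-injective (≡ᵇ⇒≡ _ _ (Equivalence.from T-≡ e))

  at-complete : ∀ {k} t → pos t ≡ k → at k t ≡ true
  at-complete t refl = ≡ᵇ-refl (toℕ (pos t))

  count : (Fin N → Col) → Fin n → Fin 3 → Fin N → ℕ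
  count c k r t = only (at k t) (only (c t ==C varCol (bcol k) r) 1)

  exponent : (Fin N → Col) → Mono n
  exponent c k r = sum (count c k r)

  valence : Fin n → ℕ
  valence k = sum (λ t → only (at k t) 1)

  exponent-degree : ∀ c k → degree (exponent c) k ≡ valence k
  exponent-degree c k = sym (trans
    (sum-split (λ t → count c k 0F t + count c k 1F t) (count c k 2F) λ t → split (at k t) (varCol-total (bcol k) (c t)))
    (cong (_+ exponent c k 2F) (∑-distrib-+ (count c k 0F) (count c k 1F))))
    where
      split : ∀ b {x y z} → x + y + z ≡ 1 → only b 1 ≡ only b x + only b y + only b z
      split true  e = sym e
      split false e = refl

  block : Fund → (Fin N → Col) → Fin n → ℕ
  block i c k = sum (λ t → only (at k t) (u i (sgn t) (c t)))

  at-cong : ∀ k {f g : Fin N → ℕ} → (∀ t → pos t ≡ k → f t ≡ g t) → ∀ t → only (at k t) (f t) ≡ only (at k t) (g t)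
  at-cong k e t with at k t in eq
  ... | true  = e t (at-sound t eq)
  ... | false = refl

  block-lowest : ∀ c k → exponent c k 0F + block (lowest (bcol k)) c k ≡ valence k
  block-lowest c k = sym (sum-split (count c k 0F) _ λ t →
    trans (sym (at-cong k (λ { t refl → u-lowest (bcol k) (c t) }) t))
          (only-+ (at k t) _ (u (lowest (bcol k)) (sgn t) (c t))))

  block-highest : ∀ c k → block (highest (bcol k)) c k ≡ exponent c k 2F
  block-highest c k = sum-cong-≗ (at-cong k λ { t refl → u-highest (bcol k) (c t) })

  block-cong : ∀ c c' k → (∀ r → exponent c k r ≡ exponent c' k r) → ∀ i → block i c k ≡ block i c' k
  block-cong c c' k e i with lowest-or-highest (bcol k) i
  ... | inj₁ refl = +-cancelˡ-≡ (exponent c k 0F) _ _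
    (trans (block-lowest c k) (trans (sym (block-lowest c' k)) (cong (_+ _) (sym (e 0F)))))
  ... | inj₂ refl = trans (block-highest c k) (trans (e 2F) (sym (block-highest c' k)))

  -- Monomials of a dominating and a dominated path

  module _ (pos-mono : ∀ t t' → toℕ t ≤ toℕ t' → toℕ (pos t) ≤ toℕ (pos t'))
           (c c' : Fin N → Col)
           (dominated : ∀ i (Q : Fin N → Bool) → PrefixClosed Q →
              sum (λ t → only (Q t) (u i (sgn t) (c' t))) ≤ sum (λ t → only (Q t) (u i (sgn t) (c t))))
    where

    below : Fund → (Fin N → Col) → ℕ → ℕ
    below i c m = sum (λ t → only (toℕ (pos t) <ᵇ m) (u i (sgn t) (c t)))

    below-suc : ∀ i c k → below i c (suc (toℕ k)) ≡ below i c (toℕ k) + block i c k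
    below-suc i c k = sum-split _ _ λ t → only-<ᵇ-suc (toℕ (pos t)) (toℕ k) (u i (sgn t) (c t))

    below-cong-suc : ∀ i m k → toℕ k ≡ m → block i c k ≡ block i c' k →
      below i c m ≡ below i c' m → below i c (suc m) ≡ below i c' (suc m)
    below-cong-suc i _ k refl e e' =
      trans (below-suc i c k) (trans (cong₂ _+_ e' e) (sym (below-suc i c' k)))

    below-cong : ∀ i m → m ≤ n → (∀ k → toℕ k < m → block i c k ≡ block i c' k) → below i c m ≡ below i c' m
    below-cong i zero    _   _ = trans (sum-zero {N} λ t → refl) (sym (sum-zero {N} λ t → refl))
    below-cong i (suc m) m<n e = below-cong-suc i m (fromℕ< m<n) (toℕ-fromℕ< m<n)
      (e (fromℕ< m<n) (≤-reflexive (cong suc (toℕ-fromℕ< m<n))))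
      (below-cong i m (<⇒≤ m<n) λ k k<m → e k (m<n⇒m<1+n k<m))

    -- Equal exponents at all earlier vertices give equal displacements, so the two paths meet just
    -- before `k`; dominance just after `k` then compares the displacements at `k`.
    block-≤ : ∀ k → (∀ k' → toℕ k' < toℕ k → ∀ r → exponent c' k' r ≡ exponent c k' r) →
      ∀ i → block i c' k ≤ block i c k
    block-≤ k same i = +-cancelˡ-≤ (below i c' (toℕ k)) _ _ (begin
      below i c' (toℕ k) + block i c' k   ≡⟨ below-suc i c' k ⟨
      below i c' (suc (toℕ k))            ≤⟨ dominated i _ closed ⟩
      below i c (suc (toℕ k))             ≡⟨ below-suc i c k ⟩
      below i c (toℕ k) + block i c k     ≡⟨ cong (_+ block i c k) (below-cong i (toℕ k) (<⇒≤ (toℕ<n k))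
                                              λ k' k'<k → block-cong c c' k' (λ r → sym (same k' k'<k r)) i) ⟩
      below i c' (toℕ k) + block i c k    ∎)
      where
        open ≤-Reasoning
        closed : PrefixClosed (λ t → toℕ (pos t) <ᵇ suc (toℕ k))
        closed t t' t≤t' q =
          <ᵇ-complete {toℕ (pos t)} (≤-<-trans (pos-mono t t' t≤t') (<ᵇ-sound (toℕ (pos t')) (suc (toℕ k)) q))

    -- At the first differing vertex dominance bounds the exponent of the first variable from below
    -- and that of the last from above. As the degrees agree, no lexicographic decrease is possible.
    not-firstLess : ¬ FirstLess (exponent c') (exponent c)
    not-firstLess (k , same , less) = absurd less
      where
        degrees : degree (exponent c') k ≡ degree (exponent c) k
        degrees = trans (exponent-degree c' k) (sym (exponent-degree c k))
        low : exponent c k 0F ≤ exponent c' k 0F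
        -- The coordinate `lowest` counts the edges not carrying the first variable, so the two
        -- counts add up to `valence k`.
        low = +-cancelʳ-≤ (block (lowest (bcol k)) c' k) _ _ (begin
          exponent c k 0F + block (lowest (bcol k)) c' k    ≤⟨ +-monoʳ-≤ _ (block-≤ k same (lowest (bcol k))) ⟩
          exponent c k 0F + block (lowest (bcol k)) c k     ≡⟨ block-lowest c k ⟩
          valence k                                         ≡⟨ block-lowest c' k ⟨
          exponent c' k 0F + block (lowest (bcol k)) c' k   ∎)
          where open ≤-Reasoning
        high : exponent c' k 2F ≤ exponent c k 2F
        high = subst₂ _≤_ (block-highest c' k) (block-highest c k) (block-≤ k same (highest (bcol k)))
        absurd : ¬ LexLess (exponent c' k) (exponent c k)
        absurd (inj₁ p) = ≤⇒≯ low p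
        absurd (inj₂ (e , inj₁ p)) = <-irrefl degrees (+-mono-<-≤ (+-mono-≤-< (≤-reflexive e) p) high)
        absurd (inj₂ (e , inj₂ (e' , p))) = <-irrefl degrees (+-mono-≤-< (≤-reflexive (cong₂ _+_ e e')) p)

    -- Rigidity of sorted paths with equal monomials

    module _ (sorted : ∀ t t' → toℕ t ≤ toℕ t' → pos t ≡ pos t' → ∀ i → u i (sgn t) (c t) ≤ u i (sgn t) (c t'))
             (same : ∀ k r → exponent c' k r ≡ exponent c k r) where

      u-≤ : ∀ t → (∀ t' → toℕ t' < toℕ t → c' t' ≡ c t') → ∀ i → u i (sgn t) (c' t) ≤ u i (sgn t) (c t)
      u-≤ t earlier i = +-cancelˡ-≤ (before c') _ _ (begin
        before c' + u i (sgn t) (c' t)        ≡⟨ split c' ⟨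
        upto c'                               ≤⟨ dominated i _ closed ⟩
        upto c                                ≡⟨ split c ⟩
        before c + u i (sgn t) (c t)          ≡⟨ cong (_+ u i (sgn t) (c t)) (sum-cong-≗ agree) ⟨
        before c' + u i (sgn t) (c t)         ∎)
        where
          open ≤-Reasoning
          before upto : (Fin N → Col) → ℕ
          before d = sum (λ t' → only (toℕ t' <ᵇ toℕ t) (u i (sgn t') (d t')))
          upto   d = sum (λ t' → only (toℕ t' <ᵇ suc (toℕ t)) (u i (sgn t') (d t')))
          closed : PrefixClosed (λ t' → toℕ t' <ᵇ suc (toℕ t))
          closed t₁ t₂ p q = <ᵇ-complete {toℕ t₁} (≤-<-trans p (<ᵇ-sound (toℕ t₂) (suc (toℕ t)) q))
          agree : ∀ t' → only (toℕ t' <ᵇ toℕ t) (u i (sgn t') (c' t')) ≡ only (toℕ t' <ᵇ toℕ t) (u i (sgn t') (c t'))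
          agree t' with toℕ t' <ᵇ toℕ t in eq
          ... | true  = cong (u i (sgn t')) (earlier t' (<ᵇ-sound _ _ eq))
          ... | false = refl
          split : ∀ d → upto d ≡ before d + u i (sgn t) (d t)
          split d = trans (sum-split _ _ λ t' → only-<ᵇ-suc (toℕ t') (toℕ t) (u i (sgn t') (d t')))
            (cong (before d +_) (trans
              (sum-single _ t λ t' ne → only-false (u i (sgn t') (d t')) λ e →
                ne (toℕ-injective (≡ᵇ⇒≡ _ _ (Equivalence.from T-≡ e))))
              (cong (λ b → only b (u i (sgn t) (d t))) (≡ᵇ-refl (toℕ t)))))

      -- Otherwise c' t is strictly below c t, hence below all later colours of c at this
      -- vertex, so c' uses the colour c' t at this vertex more often than c does.
      agree-at : ∀ t → (∀ t' → toℕ t' < toℕ t → c' t' ≡ c t') → c' t ≡ c t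
      agree-at t earlier with c' t ≟C c t
      ... | yes e = e
      ... | no ne = contradiction (same k r) (≢-sym (<⇒≢ (sum-mono-< weak t strict)))
        where
          k = pos t
          r = varIndex (bcol k) (c' t)
          r-col : varCol (bcol k) r ≡ c' t
          r-col = varCol-varIndex (bcol k) (c' t)
          f g : Fin N → ℕ
          f = count c k r
          g = count c' k r
          f-zero : ∀ t' → c t' ≢ c' t → only (c t' ==C varCol (bcol k) r) 1 ≡ 0
          f-zero t' p = only-false 1 λ e → p (trans (==C-sound _ _ e) r-col)
          later : ∀ t' → toℕ t ≤ toℕ t' → pos t' ≡ k → c t' ≢ c' t
          later t' t≤t' e eq = ne (sym (u-injective (sgn t) _ _ λ i → ≤-antisym
            (subst (λ x → u i (sgn t) (c t) ≤ u i (sgn t) x) eq (sorted t t' t≤t' (sym e) i))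
            (u-≤ t earlier i)))
          weak : ∀ t' → f t' ≤ g t'
          weak t' with at k t' in eq
          ... | false = z≤n
          ... | true with <-≤-connex (toℕ t') (toℕ t)
          ...   | inj₁ t'<t = ≤-reflexive (cong (λ x → only (x ==C varCol (bcol k) r) 1) (sym (earlier t' t'<t)))
          ...   | inj₂ t≤t' rewrite f-zero t' (later t' t≤t' (at-sound t' eq)) = z≤n
          strict : f t < g t
          strict rewrite ≡ᵇ-refl (toℕ k) | f-zero t (later t ≤-refl refl) | r-col | ==C-refl (c' t) = s≤s z≤n

      exponent-rigid : ∀ t → c' t ≡ c t
      exponent-rigid t = go (toℕ t) t ≤-refl
        where
          go : ∀ m t → toℕ t ≤ m → c' t ≡ c t
          go zero    t p = agree-at t λ t' q → contradiction (<-≤-trans q p) λ ()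
          go (suc m) t p = agree-at t λ t' q → go m t' (≤-pred (<-≤-trans q p))

dom-prefix : ∀ γ i {N} (f : Fin N → Dang) (Q : Fin N → Bool) → PrefixClosed Q → ∀ {a b} →
  Dom γ i a b (tabulate f) →
  b + sum (λ t → only (Q t) (u i (Dang.dsgn (f t)) (γ (Dang.dtop (f t)))))
    ≤ a + sum (λ t → only (Q t) (u i (Dang.dsgn (f t)) (ecol (Dang.dsgn (f t)) (Dang.dst (f t)))))
dom-prefix γ i {zero}  f Q closed D = +-monoˡ-≤ 0 D
dom-prefix γ i {suc N} f Q closed {a} {b} (d , D) with Q zero in Q0
... | true  = subst₂ _≤_ (+-assoc b _ _) (+-assoc a _ _)
                (dom-prefix γ i (f ∘ suc) (Q ∘ suc) (λ t t' p → closed (suc t) (suc t') (s≤s p)) D)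
-- Position `zero` lies outside `Q`, so prefix-closedness empties `Q` and both sums vanish.
... | false = subst₂ _≤_ (empty b) (empty a) d
  where
    none : ∀ {w : Fin N → ℕ} t → only (Q (suc t)) (w t) ≡ 0
    none t = only-false _ λ e → contradiction (trans (sym (closed zero (suc t) z≤n e)) Q0) λ ()
    empty : ∀ a {w : Fin N → ℕ} → a ≡ a + sum (λ t → only (Q (suc t)) (w t))
    empty a = sym (trans (cong (a +_) (sum-zero none)) (+-identityʳ a))

-- Signed sums over colourings

sumℤ : List ℤ → ℤ
sumℤ = foldr ℤ._+_ 0ℤ

module _ {A : Set} where

  sumℤ-zero : ∀ {g : A → ℤ} xs → (∀ x → g x ≡ 0ℤ) → sumℤ (map g xs) ≡ 0ℤ
  sumℤ-zero []       e = refl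
  sumℤ-zero (x ∷ xs) e = cong₂ ℤ._+_ (e x) (sumℤ-zero xs e)

  sumℤ-map-++ : ∀ {B : Set} (g : A → ℤ) (h : B → A) xs ys →
    sumℤ (map g (map h xs ++ ys)) ≡ sumℤ (map (g ∘ h) xs) ℤ.+ sumℤ (map g ys)
  sumℤ-map-++ g h []       ys = sym (ℤ.+-identityˡ _)
  sumℤ-map-++ g h (x ∷ xs) ys =
    trans (cong (λ y → g (h x) ℤ.+ y) (sumℤ-map-++ g h xs ys)) (sym (ℤ.+-assoc (g (h x)) _ _))

-- Colourings are functions, so the surviving term is singled out by `≗`. At each edge exactly one
-- of the three branches of the enumeration matches `ℓ`.
sumℤ-allCols : ∀ E (g : (Fin E → Col) → ℤ) ℓ s →
  (∀ f → f ≗ ℓ → g f ≡ s) → (∀ f → ¬ (f ≗ ℓ) → g f ≡ 0ℤ) → sumℤ (map g (allCols E)) ≡ s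
sumℤ-allCols zero    g ℓ s on off = trans (ℤ.+-identityʳ _) (on _ λ ())
sumℤ-allCols (suc E) g ℓ s on off =
  trans (sumℤ-map-++ g _ (allCols E) _) (trans (cong₂ ℤ._+_ (part _ m1 (λ _ → refl) (λ _ _ → refl))
    (trans (sumℤ-map-++ g _ (allCols E) _) (cong₂ ℤ._+_ (part _ z0 (λ _ → refl) (λ _ _ → refl))
      (trans (sumℤ-map-++ g _ (allCols E) _) (cong₂ ℤ._+_ (part _ p1 (λ _ → refl) (λ _ _ → refl)) refl)))))
    (total (ℓ zero)))
  where
    -- `h` stands for prepending the colour `c` and is known only through its two equations.
    part : ∀ h c → (∀ f → h f zero ≡ c) → (∀ f i → h f (suc i) ≡ f i) →
      sumℤ (map (g ∘ h) (allCols E)) ≡ (if c ==C ℓ zero then s else 0ℤ)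
    part h c h0 hs with c ==C ℓ zero in eq
    ... | true  = sumℤ-allCols E (g ∘ h) (ℓ ∘ suc) s
      (λ f e → on (h f) λ { zero → trans (h0 f) (==C-sound c (ℓ zero) eq) ; (suc i) → trans (hs f i) (e i) })
      (λ f ne → off (h f) λ e → ne λ i → trans (sym (hs f i)) (e (suc i)))
    ... | false = sumℤ-zero (allCols E) λ f → off (h f) λ e →
      contradiction (trans (sym (subst (λ x → (x ==C ℓ zero) ≡ true) (trans (sym (e zero)) (h0 f)) (==C-refl (ℓ zero)))) eq) λ ()
    total : ∀ c → (if m1 ==C c then s else 0ℤ) ℤ.+ ((if z0 ==C c then s else 0ℤ) ℤ.+ ((if p1 ==C c then s else 0ℤ) ℤ.+ 0ℤ)) ≡ s
    total m1 = ℤ.+-identityʳ s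
    total z0 = trans (ℤ.+-identityˡ _) (ℤ.+-identityʳ s)
    total p1 = trans (ℤ.+-identityˡ _) (trans (ℤ.+-identityˡ _) (ℤ.+-identityʳ s))

IsUnit : ℤ → Set
IsUnit z = z ≡ 1ℤ ⊎ z ≡ -1ℤ

unit-* : ∀ {x y} → IsUnit x → IsUnit y → IsUnit (x ℤ.* y)
unit-* (inj₁ refl) (inj₁ refl) = inj₁ refl
unit-* (inj₁ refl) (inj₂ refl) = inj₂ refl
unit-* (inj₂ refl) (inj₁ refl) = inj₂ refl
unit-* (inj₂ refl) (inj₂ refl) = inj₁ refl

unit-≢0 : ∀ {x} → IsUnit x → x ≢ 0ℤ
unit-≢0 (inj₁ refl) ()
unit-≢0 (inj₂ refl) ()

unit-product : ∀ {A : Set} {g : A → ℤ} → (∀ x → IsUnit (g x)) → ∀ xs → IsUnit (foldr ℤ._*_ 1ℤ (map g xs))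
unit-product p []       = inj₁ refl
unit-product p (x ∷ xs) = unit-* (p x) (unit-product p xs)

sgn3-unit : ∀ a b c → IsUnit (sgn3 a b c)
sgn3-unit m1 m1 _  = inj₂ refl
sgn3-unit m1 z0 m1 = inj₂ refl
sgn3-unit m1 z0 z0 = inj₂ refl
sgn3-unit m1 z0 p1 = inj₁ refl
sgn3-unit m1 p1 _  = inj₂ refl
sgn3-unit z0 m1 _  = inj₂ refl
sgn3-unit z0 z0 _  = inj₂ refl
sgn3-unit z0 p1 m1 = inj₁ refl
sgn3-unit z0 p1 z0 = inj₂ refl
sgn3-unit z0 p1 p1 = inj₂ refl
sgn3-unit p1 m1 m1 = inj₂ refl
sgn3-unit p1 m1 z0 = inj₁ refl
sgn3-unit p1 m1 p1 = inj₂ refl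
sgn3-unit p1 z0 _  = inj₂ refl
sgn3-unit p1 p1 _  = inj₂ refl

-- Webs and their grown models

∧-true : ∀ {a b} → a ∧ b ≡ true → a ≡ true × b ≡ true
∧-true {true} {true} _ = refl , refl

all-tabulate⁻ : ∀ {A : Set} {n} (p : A → Bool) (f : Fin n → A) → all p (tabulate f) ≡ true → ∀ i → p (f i) ≡ true
all-tabulate⁻ p f e zero    = proj₁ (∧-true e)
all-tabulate⁻ p f e (suc i) = all-tabulate⁻ p (f ∘ suc) (proj₂ (∧-true {p (f zero)} e)) i

all-tabulate⁺ : ∀ {A : Set} {n} (p : A → Bool) (f : Fin n → A) → (∀ i → p (f i) ≡ true) → all p (tabulate f) ≡ true
all-tabulate⁺ {n = zero}  p f e = refl
all-tabulate⁺ {n = suc n} p f e = cong₂ _∧_ (e zero) (all-tabulate⁺ p (f ∘ suc) (e ∘ suc))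

distinct3⇒rainbow : ∀ a b c → distinct3 a b c ≡ true → Rainbow a b c
distinct3⇒rainbow m1 z0 p1 _ = m0p
distinct3⇒rainbow m1 p1 z0 _ = mp0
distinct3⇒rainbow z0 m1 p1 _ = 0mp
distinct3⇒rainbow z0 p1 m1 _ = 0pm
distinct3⇒rainbow p1 m1 z0 _ = pm0
distinct3⇒rainbow p1 z0 m1 _ = p0m

rainbow⇒distinct3 : ∀ {a b c} → Rainbow a b c → distinct3 a b c ≡ true
rainbow⇒distinct3 m0p = refl
rainbow⇒distinct3 mp0 = refl
rainbow⇒distinct3 0mp = refl
rainbow⇒distinct3 0pm = refl
rainbow⇒distinct3 pm0 = refl
rainbow⇒distinct3 p0m = refl

rainbow-rotate : ∀ {a b c} → Rainbow a b c → Rainbow b c a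
rainbow-rotate m0p = 0pm
rainbow-rotate mp0 = p0m
rainbow-rotate 0mp = mp0
rainbow-rotate 0pm = pm0
rainbow-rotate pm0 = m0p
rainbow-rotate p0m = 0mp

neg3 : Fin 3 → Fin 3
neg3 0F = 0F
neg3 1F = 2F
neg3 2F = 1F

add3-neg3 : ∀ j r → add3 (add3 j r) (neg3 r) ≡ j
add3-neg3 j  0F = refl
add3-neg3 0F 1F = refl
add3-neg3 1F 1F = refl
add3-neg3 2F 1F = refl
add3-neg3 0F 2F = refl
add3-neg3 1F 2F = refl
add3-neg3 2F 2F = refl

rainbow-add3 : ∀ (f : Fin 3 → Col) r → Rainbow (f 0F) (f 1F) (f 2F) →
  Rainbow (f (add3 0F r)) (f (add3 1F r)) (f (add3 2F r))
rainbow-add3 f 0F p = p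
rainbow-add3 f 1F p = rainbow-rotate p
rainbow-add3 f 2F p = rainbow-rotate (rainbow-rotate p)

-- `YTab` lists exactly the strict descents of states, and both coordinates grow weakly with the
-- state.
ascent : ∀ i s j j' → (∀ j'' → ¬ YTab j j' j'') → u i s (ecol s j) ≤ u i s (ecol s j')
ascent i s m1 j' _ = subst (_≤ u i s (ecol s j')) (sym (u-bottom i s)) z≤n
ascent i s z0 m1 n = contradiction y0m (n m1)
ascent i s z0 z0 _ = ≤-refl
ascent i s j  p1 _ = subst (u i s (ecol s j) ≤_) (sym (u-top i s)) (u≤1 i s (ecol s j))
ascent i s p1 m1 n = contradiction y1m (n z0)
ascent i s p1 z0 n = contradiction y10 (n p1)

adjacent-tabulate : ∀ {N} (f : Fin N → Dang) t t' → toℕ t' ≡ suc (toℕ t) → Adjacent (f t) (f t') (tabulate f)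
adjacent-tabulate f zero    (suc zero) refl = here
adjacent-tabulate f (suc t) (suc t')   e    = there (adjacent-tabulate (f ∘ suc) t t' (suc-injective e))

sgnCol-injective : ∀ s b → sgnCol s ≡ b → s ≡ sgnOf b
sgnCol-injective plus  _ refl = refl
sgnCol-injective minus _ refl = refl

opposite : VColor → VColor
opposite black = white
opposite white = black

gEnd-orient : ∀ s x y c → gEnd (sgnCol s) (orient s x y c) ≡ x
gEnd-orient plus  x y c = refl
gEnd-orient minus x y c = refl

gEnd-orient-opposite : ∀ s x y c → gEnd (opposite (sgnCol s)) (orient s x y c) ≡ y
gEnd-orient-opposite plus  x y c = refl
gEnd-orient-opposite minus x y c = refl

-- Colourings of a web and coefficients of its invariant

module Diagram (D : Web) where
  open W D
  open Inv D

  endAt-color : ∀ s e → [ bcol , icol ] (endAt diag s e) ≡ s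
  endAt-color black e = bEnd-black e
  endAt-color white e = wEnd-white e

  bnd-color : ∀ {s e i} → endAt diag s e ≡ inj₁ i → bcol i ≡ s
  bnd-color {s} {e} p = trans (cong [ bcol , icol ] (sym p)) (endAt-color s e)

  int-color : ∀ {s e v} → endAt diag s e ≡ inj₂ v → icol v ≡ s
  int-color {s} {e} p = trans (cong [ bcol , icol ] (sym p)) (endAt-color s e)

  bp-color : ∀ t → bcol (bpv t) ≡ proj₂ (bp t)
  bp-color t = bnd-color (bp-at t)

  bp-injectiveˡ : ∀ t t' → bpv t ≡ bpv t' → proj₁ (bp t) ≡ proj₁ (bp t') → t ≡ t'
  bp-injectiveˡ t t' e e' = bp-inj t t'
    (cong₂ _,_ e' (trans (sym (bp-color t)) (trans (cong bcol e) (bp-color t'))))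

  open Boundary bcol bpv

  bndColors : (Fin E → Col) → Fin N → Col
  bndColors ℓ t = ℓ (proj₁ (bp t))

  touches : Fin n → Fin E → Bool
  touches i e = isBnd (bEnd e) i ∨ isBnd (wEnd e) i

  isBnd-sound : ∀ x i → isBnd x i ≡ true → x ≡ inj₁ i
  isBnd-sound (inj₁ j) i e = cong inj₁ (toℕ-injective (≡ᵇ⇒≡ _ _ (Equivalence.from T-≡ e)))

  touches-sound : ∀ i e → touches i e ≡ true → ∃[ s ] endAt diag s e ≡ inj₁ i
  touches-sound i e p with isBnd (bEnd e) i in eq
  ... | true  = black , isBnd-sound (bEnd e) i eq
  ... | false = white , isBnd-sound (wEnd e) i p

  touches-complete : ∀ s {i e} → endAt diag s e ≡ inj₁ i → touches i e ≡ true
  touches-complete black {i} {e} p rewrite p | ≡ᵇ-refl (toℕ i) = refl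
  touches-complete white {i} {e} p rewrite p | ≡ᵇ-refl (toℕ i) with isBnd (bEnd e) i
  ... | true  = refl
  ... | false = refl

  -- The colour of vertex `i` decides which end of an edge can lie at `i`, so the edges touching `i`
  -- correspond one to one to the boundary points at `i`.
  mon-exponent : ∀ ℓ i r → mon ℓ i r ≡ exponent (bndColors ℓ) i r
  mon-exponent ℓ i r = begin
    mon ℓ i r                                    ≡⟨ countB-tabulate {n = E} _ id ⟩
    sum (λ e → only (touches i e ∧ hit e) 1)     ≡⟨ sum-cong-≗ (λ e → only-∧ (touches i e) (hit e)) ⟩
    sum (λ e → only (touches i e) (only (hit e) 1)) ≡⟨ sum-reindex (touches i) (at i) (proj₁ ∘ bp) _ into onto once ⟩
    exponent (bndColors ℓ) i r                   ∎
    where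
      open ≡-Reasoning
      hit : Fin E → Bool
      hit e = ℓ e ==C varCol (bcol i) r
      into : ∀ t → at i t ≡ true → touches i (proj₁ (bp t)) ≡ true
      into t p = touches-complete (proj₂ (bp t)) (trans (bp-at t) (cong inj₁ (at-sound t p)))
      onto : ∀ e → touches i e ≡ true → ∃[ t ] at i t ≡ true × proj₁ (bp t) ≡ e
      onto e p with touches-sound i e p
      ... | s , q with bp-surj e s i q
      ...   | t , bt = t , at-complete t (inj₁-injective (trans (sym (bp-at t))
                (subst (λ x → endAt diag (proj₂ x) (proj₁ x) ≡ inj₁ i) (sym bt) q))) , cong proj₁ bt
      once : ∀ t t' → at i t ≡ true → at i t' ≡ true → proj₁ (bp t) ≡ proj₁ (bp t') → t ≡ t'
      once t t' p p' = bp-injectiveˡ t t' (trans (at-sound t p) (sym (at-sound t' p')))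

  Proper : (Fin E → Col) → Set
  Proper ℓ = ∀ v → Rainbow (ℓ (rot v 0F)) (ℓ (rot v 1F)) (ℓ (rot v 2F))

  proper-sound : ∀ ℓ → proper ℓ ≡ true → Proper ℓ
  proper-sound ℓ p v = distinct3⇒rainbow _ _ _ (all-tabulate⁻ {n = k} _ id p v)

  proper-complete : ∀ ℓ → Proper ℓ → proper ℓ ≡ true
  proper-complete ℓ p = all-tabulate⁺ {n = k} _ id λ v → rainbow⇒distinct3 (p v)

  proper-cong : ∀ {ℓ ℓ'} → ℓ ≗ ℓ' → Proper ℓ' → Proper ℓ
  proper-cong e p v = rainbow-cong (e _) (e _) (e _) (p v)

  sign-cong : ∀ {ℓ ℓ'} → ℓ ≗ ℓ' → sign ℓ ≡ sign ℓ'
  sign-cong {ℓ} {ℓ'} e = cong (foldr ℤ._*_ 1ℤ) (map-cong same (allFin k))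
    where
      same : ∀ v → sgn3 (ℓ (rot v 0F)) (ℓ (rot v 1F)) (ℓ (rot v 2F)) ≡ sgn3 (ℓ' (rot v 0F)) (ℓ' (rot v 1F)) (ℓ' (rot v 2F))
      same v rewrite e (rot v 0F) | e (rot v 1F) | e (rot v 2F) = refl

  -- Under these conditions only `ℓ` contributes to the coefficient of its monomial, which is
  -- therefore a single sign, and no proper colouring contributes to a larger monomial.
  leading-criterion : ∀ ℓ → Proper ℓ →
    (∀ ℓ' → Proper ℓ' → ¬ FirstLess (exponent (bndColors ℓ')) (exponent (bndColors ℓ))) →
    (∀ ℓ' → Proper ℓ' → (∀ i r → exponent (bndColors ℓ') i r ≡ exponent (bndColors ℓ) i r) → ℓ' ≗ ℓ) →
    IsLeading (mon ℓ) × IsUnit (coeff (mon ℓ))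
  leading-criterion ℓ ℓ-proper not-larger unique =
    (unit-≢0 unit , vanish) , unit
    where
      flatten-mon : ∀ ℓ → flatten (mon ℓ) ≡ flat (exponent (bndColors ℓ))
      flatten-mon ℓ = trans (flatten-flat (mon ℓ)) (flat-cong (mon-exponent ℓ))
      flatten-cong : ∀ {ℓ ℓ'} → ℓ ≗ ℓ' → flatten (mon ℓ) ≡ flatten (mon ℓ')
      flatten-cong {ℓ} {ℓ'} e = trans (flatten-mon ℓ) (trans
        (flat-cong λ i r → sum-cong-≗ λ t →
          cong (λ c → only (at i t) (only (c ==C varCol (bcol i) r) 1)) (e (proj₁ (bp t))))
        (sym (flatten-mon ℓ')))
      mon-sum : ∀ ℓ ℓ' → sumℕ (flatten (mon ℓ)) ≡ sumℕ (flatten (mon ℓ'))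
      mon-sum ℓ ℓ' = trans (cong sumℕ (flatten-mon ℓ)) (trans
        (sum-flat-cong λ i → trans (exponent-degree (bndColors ℓ) i) (sym (exponent-degree (bndColors ℓ') i)))
        (cong sumℕ (sym (flatten-mon ℓ'))))

      term : Mono n → (Fin E → Col) → ℤ
      term μ ℓ' = if proper ℓ' ∧ eqL (flatten (mon ℓ')) (flatten μ) then sign ℓ' else 0ℤ

      term-zero : ∀ μ ℓ' → (Proper ℓ' → flatten (mon ℓ') ≡ flatten μ → ⊥) → term μ ℓ' ≡ 0ℤ
      term-zero μ ℓ' p with proper ℓ' in e
      ... | false = refl
      ... | true with eqL (flatten (mon ℓ')) (flatten μ) in e'
      ...   | false = refl
      ...   | true  = ⊥-elim (p (proper-sound ℓ' e) (eqL-sound _ _ e'))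

      on : ∀ ℓ' → ℓ' ≗ ℓ → term (mon ℓ) ℓ' ≡ sign ℓ
      on ℓ' e rewrite proper-complete ℓ' (proper-cong e ℓ-proper) | flatten-cong e
                    | eqL-refl (flatten (mon ℓ)) = sign-cong e

      off : ∀ ℓ' → ¬ (ℓ' ≗ ℓ) → term (mon ℓ) ℓ' ≡ 0ℤ
      off ℓ' ne = term-zero (mon ℓ) ℓ' λ p e → ne (unique ℓ' p (flat-injective
        (trans (sym (flatten-mon ℓ')) (trans e (flatten-mon ℓ)))))

      coeff-sign : coeff (mon ℓ) ≡ sign ℓ
      coeff-sign = sumℤ-allCols E (term (mon ℓ)) ℓ (sign ℓ) on off

      unit : IsUnit (coeff (mon ℓ))
      unit = subst IsUnit (sym coeff-sign) (unit-product (λ v → sgn3-unit _ _ _) (allFin k))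

      vanish : ∀ μ → μ >ₘ mon ℓ → coeff μ ≡ 0ℤ
      vanish μ larger = sumℤ-zero (allCols E) λ ℓ' → term-zero μ ℓ' (absurd ℓ' larger)
        where
          absurd : ∀ ℓ' → μ >ₘ mon ℓ → Proper ℓ' → flatten (mon ℓ') ≡ flatten μ → ⊥
          -- The degree at each vertex is its valence for every colouring, so total degrees cannot
          -- differ.
          absurd ℓ' (inj₁ q) p e =
            <-irrefl (trans (mon-sum ℓ ℓ') (cong sumℕ e)) q
          absurd ℓ' (inj₂ (_ , q)) p e = not-larger ℓ' p (revGt⇒firstLess
            (subst₂ RevGt (trans (sym e) (flatten-mon ℓ')) (flatten-mon ℓ) q))

  half-edge : ∀ e s → (∃[ v ] ∃[ j ] endAt diag s e ≡ inj₂ v × rot v j ≡ e × icol v ≡ s) ⊎ (∃[ t ] bp t ≡ (e , s))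
  half-edge e s with endAt diag s e in eq
  ... | inj₁ i = inj₂ (bp-surj e s i eq)
  ... | inj₂ v with rot-all v e (incident s eq)
    where
      incident : ∀ s → endAt diag s e ≡ inj₂ v → (bEnd e ≡ inj₂ v) ⊎ (wEnd e ≡ inj₂ v)
      incident black p = inj₁ p
      incident white p = inj₂ p
  ...   | j , p = inj₁ (v , j , refl , p , int-color eq)

  -- Transfer of colourings between the web and its grown model

  module Grown {nF : ℕ} {es : List GEdge}
    (φV : Fin k ↔ Fin nF) (φE : Fin E ↔ Fin (length es)) (r : Fin k → Fin 3)
    (int-end : ∀ v j → gEnd (icol v) (lookup es (Inverse.to φE (rot v j))) ≡ int (toℕ (Inverse.to φV v)) (add3 j (r v)))
    (bnd-end : ∀ t → gEnd (proj₂ (bp t)) (lookup es (Inverse.to φE (proj₁ (bp t)))) ≡ bnd (toℕ t))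
    where

    grown : Fin E → GEdge
    grown e = lookup es (Inverse.to φE e)

    ungrow : ∀ i → ∃[ e ] grown e ≡ lookup es i
    ungrow i = Inverse.from φE i , cong (lookup es) (Inverse.strictlyInverseˡ φE i)

    All-grown : ∀ {P : GEdge → Set} → (∀ e → P (grown e)) → All P es
    All-grown {P} p = subst (All P) (tabulate-lookup es)
      (tabulate⁺ λ i → subst P (proj₂ (ungrow i)) (p (proj₁ (ungrow i))))

    end-int : ∀ s e {m a} → gEnd s (grown e) ≡ int m a → ∃[ v ] endAt diag s e ≡ inj₂ v × toℕ (Inverse.to φV v) ≡ m
    end-int s e p with half-edge e s
    ... | inj₁ (v , j , q , refl , refl) = v , q , int-injective (trans (sym (int-end v j)) p)
      where
        int-injective : ∀ {m m' a a'} → int m a ≡ int m' a' → m ≡ m'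
        int-injective refl = refl
    ... | inj₂ (t , refl) = contradiction (trans (sym (bnd-end t)) p) λ ()

    end-bnd : ∀ s e t → gEnd s (grown e) ≡ bnd (toℕ t) → bp t ≡ (e , s)
    end-bnd s e t p with half-edge e s
    ... | inj₁ (v , j , q , refl , refl) = contradiction (trans (sym (int-end v j)) p) λ ()
    ... | inj₂ (t' , refl) = cong bp (toℕ-injective (bnd-injective (trans (sym p) (bnd-end t'))))
      where
        bnd-injective : ∀ {m m'} → bnd m ≡ bnd m' → m ≡ m'
        bnd-injective refl = refl

    -- The values at ends that do not occur in the grown web only serve to keep Γ ℓ proper.
    Γ : (Fin E → Col) → GEnd → Col
    Γ ℓ (bnd t) with t <? N
    ... | yes p = ℓ (proj₁ (bp (fromℕ< p)))
    ... | no  _ = m1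
    Γ ℓ (int v a) with v <? nF
    ... | yes p = ℓ (rot w (add3 a (neg3 (r w))))
      where w = Inverse.from φV (fromℕ< p)
    ... | no  _ = varCol black a

    Γ-bnd : ∀ ℓ t → Γ ℓ (bnd (toℕ t)) ≡ ℓ (proj₁ (bp t))
    Γ-bnd ℓ t with toℕ t <? N
    ... | yes p = cong (λ t → ℓ (proj₁ (bp t))) (fromℕ<-toℕ t p)
    ... | no  p = contradiction (toℕ<n t) p

    Γ-int : ∀ ℓ v j → Γ ℓ (int (toℕ (Inverse.to φV v)) (add3 j (r v))) ≡ ℓ (rot v j)
    Γ-int ℓ v j with toℕ (Inverse.to φV v) <? nF
    ... | no  p = contradiction (toℕ<n (Inverse.to φV v)) p
    ... | yes p = rotate _ (trans (cong (Inverse.from φV) (fromℕ<-toℕ _ p)) (Inverse.strictlyInverseʳ φV v))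
      where
        -- Generalised over `w` so that the round trip through `φV` can be matched with `refl`; the
        -- two rotations then cancel.
        rotate : ∀ w → w ≡ v → ℓ (rot w (add3 (add3 j (r v)) (neg3 (r w)))) ≡ ℓ (rot v j)
        rotate _ refl = cong (λ i → ℓ (rot v i)) (add3-neg3 j (r v))

    Γ-edge : ∀ ℓ s e → Γ ℓ (gEnd s (grown e)) ≡ ℓ e
    Γ-edge ℓ s e with half-edge e s
    ... | inj₁ (v , j , _ , refl , refl) = trans (cong (Γ ℓ) (int-end v j)) (Γ-int ℓ v j)
    ... | inj₂ (t , refl)                = trans (cong (Γ ℓ) (bnd-end t)) (Γ-bnd ℓ t)

    Γ-compatible : ∀ ℓ → All (Compatible (Γ ℓ)) es
    Γ-compatible ℓ = All-grown λ e → trans (Γ-edge ℓ black e) (sym (Γ-edge ℓ white e))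

    Γ-proper : ∀ ℓ → Proper ℓ → ∀ v → ProperAt (Γ ℓ) v
    Γ-proper ℓ p v with v <? nF
    ... | yes q = rainbow-add3 (λ a → ℓ (rot w a)) (neg3 (r w)) (p w)
      where w = Inverse.from φV (fromℕ< q)
    ... | no  _ = m0p

    -- Boundary points distinct in the unclasping may share a vertex of the web; their prongs then
    -- have both ends in common, and simplicity identifies them.
    double-edge : ∀ {s t t'} → Fork s (bnd (toℕ t)) (bnd (toℕ t')) es → bpv t ≡ bpv t' →
      (∀ e e' → bEnd e ≡ bEnd e' → wEnd e ≡ wEnd e' → e ≡ e') → t ≡ t'
    double-edge {s} {t} {t'} (v , (a , c , p) , (b , c' , p')) pos-eq simple
      with prong t p | prong t' p'
      where
        prong : ∀ t {v a c} → orient s (bnd (toℕ t)) (int v a) c ∈ es →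
          ∃[ e ] bp t ≡ (e , sgnCol s) × (∃[ w ] endAt diag (opposite (sgnCol s)) e ≡ inj₂ w × toℕ (Inverse.to φV w) ≡ v)
        prong t {v} {a} {c} q = e ,
            end-bnd (sgnCol s) e t (trans (cong (gEnd (sgnCol s)) is-prong) (gEnd-orient s (bnd (toℕ t)) (int v a) c)) ,
            end-int (opposite (sgnCol s)) e (trans (cong (gEnd (opposite (sgnCol s))) is-prong)
              (gEnd-orient-opposite s (bnd (toℕ t)) (int v a) c))
          where
            e = proj₁ (ungrow (index q))
            is-prong : grown e ≡ orient s (bnd (toℕ t)) (int v a) c
            is-prong = trans (proj₂ (ungrow (index q))) (sym (lookup-index q))
    ... | e , e-bp , w , e-w , w-v | e' , e'-bp , w' , e'-w' , w'-v =
      bp-inj t t' (trans e-bp (trans (cong (_, sgnCol s) (same-ends (sgnCol s) bottom top)) (sym e'-bp)))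
      where
        foot : ∀ {t e} → bp t ≡ (e , sgnCol s) → endAt diag (sgnCol s) e ≡ inj₁ (bpv t)
        foot {t} q = subst (λ x → endAt diag (proj₂ x) (proj₁ x) ≡ inj₁ (bpv t)) q (bp-at t)
        bottom : endAt diag (sgnCol s) e ≡ endAt diag (sgnCol s) e'
        bottom = trans (foot e-bp) (trans (cong inj₁ pos-eq) (sym (foot e'-bp)))
        w≡w' : w ≡ w'
        w≡w' = trans (sym (Inverse.strictlyInverseʳ φV w)) (trans
          (cong (Inverse.from φV) (toℕ-injective (trans w-v (sym w'-v)))) (Inverse.strictlyInverseʳ φV w'))
        top : endAt diag (opposite (sgnCol s)) e ≡ endAt diag (opposite (sgnCol s)) e'
        top = trans e-w (trans (cong inj₂ w≡w') (sym e'-w'))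
        same-ends : ∀ b → endAt diag b e ≡ endAt diag b e' →
          endAt diag (opposite b) e ≡ endAt diag (opposite b) e' → e ≡ e'
        same-ends black = simple e e'
        same-ends white p q = simple e e' q p

    -- The KK-colouring gives the leading term

    module Leading
      (simple : ∀ e e' → bEnd e ≡ bEnd e' → wEnd e ≡ wEnd e' → e ≡ e')
      (str : Fin N → Sgn × Col) (signs : ∀ t → sgnCol (proj₁ (str t)) ≡ bcol (bpv t))
      (ℓ : Fin E → Col) (ℓ-gc : ∀ e → ℓ e ≡ GEdge.gc (grown e))
      (run : Run 0 (tabulate (λ t → dang (proj₁ (str t)) (proj₂ (str t)) (bnd (toℕ t)))) nF es)
      where

      start : Fin N → Dang
      start t = dang (proj₁ (str t)) (proj₂ (str t)) (bnd (toℕ t))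

      str-sgn : ∀ t → proj₁ (str t) ≡ sgn t
      str-sgn t = sgnCol-injective _ _ (signs t)

      ℓ-tinted : All (Tinted (Γ ℓ)) es
      ℓ-tinted = All-grown λ e → trans (Γ-edge ℓ black e) (ℓ-gc e) , trans (Γ-edge ℓ white e) (ℓ-gc e)

      ℓ-bnd : ∀ t → bndColors ℓ t ≡ ecol (proj₁ (str t)) (proj₂ (str t))
      ℓ-bnd t = trans (sym (Γ-bnd ℓ t)) (tabulate⁻ {f = start} (tinted⇒agrees (Γ ℓ) run ℓ-tinted) t)

      ℓ-proper : Proper ℓ
      ℓ-proper v = rainbow-cong (sym (Γ-int ℓ v 0F)) (sym (Γ-int ℓ v 1F)) (sym (Γ-int ℓ v 2F))
        (rainbow-add3 (λ a → Γ ℓ (int (toℕ (Inverse.to φV v)) a)) (r v)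
          (tinted⇒proper (Γ ℓ) run ℓ-tinted _ z≤n (toℕ<n _)))

      dominated : ∀ ℓ' → Proper ℓ' → ∀ i (Q : Fin N → Bool) → PrefixClosed Q →
        sum (λ t → only (Q t) (u i (sgn t) (bndColors ℓ' t))) ≤ sum (λ t → only (Q t) (u i (sgn t) (bndColors ℓ t)))
      dominated ℓ' p i Q closed = subst₂ _≤_
        (sum-cong-≗ λ t → cong (only (Q t)) (cong₂ (u i) (str-sgn t) (Γ-bnd ℓ' t)))
        (sum-cong-≗ λ t → cong (only (Q t)) (cong₂ (u i) (str-sgn t) (sym (ℓ-bnd t))))
        (dom-prefix (Γ ℓ') i start Q closed {0} {0}
          (dom-run (Γ ℓ') (Γ-proper ℓ' p) i run (Γ-compatible ℓ')))

      Ascending : Fin N → Fin N → Set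
      Ascending t t' = ∀ i → u i (sgn t) (bndColors ℓ t) ≤ u i (sgn t) (bndColors ℓ t')

      sorted-next : ∀ t t' → toℕ t' ≡ suc (toℕ t) → bpv t ≡ bpv t' → Ascending t t'
      sorted-next t t' next pos-eq i = subst₂ _≤_
        (cong₂ (u i) (str-sgn t) (sym (ℓ-bnd t)))
        (cong₂ (u i) (str-sgn t) (trans (cong (λ s → ecol s (proj₂ (str t'))) same-sgn) (sym (ℓ-bnd t'))))
        (ascent i (proj₁ (str t)) (proj₂ (str t)) (proj₂ (str t')) no-descent)
        where
          same-sgn : proj₁ (str t) ≡ proj₁ (str t')
          same-sgn = trans (str-sgn t) (trans (cong (sgnOf ∘ bcol) pos-eq) (sym (str-sgn t')))
          no-descent : ∀ j'' → ¬ YTab (proj₂ (str t)) (proj₂ (str t')) j''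
          -- The two points are consecutive, hence distinct, whereas a fork would identify them.
          no-descent j'' y = contradiction (trans (sym next) (cong toℕ (sym
            (double-edge {t = t} {t'} (descent⇒fork y
              (subst (λ s → Adjacent (start t) (dang s (proj₂ (str t')) (bnd (toℕ t'))) (tabulate start)) (sym same-sgn)
                (adjacent-tabulate start t t' next)) run) pos-eq simple)))) 1+n≢n

      -- By `bp-mono`, every point between two points of one vertex lies at that vertex too, so the
      -- comparisons of consecutive points chain together.
      sorted : ∀ t t' → toℕ t ≤ toℕ t' → bpv t ≡ bpv t' → Ascending t t'
      sorted t t' t≤t' = go (toℕ t' ℕ.∸ toℕ t) t' (sym (m∸n+n≡m t≤t'))
        where
          go : ∀ d t' → toℕ t' ≡ d + toℕ t → bpv t ≡ bpv t' → Ascending t t'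
          go zero t' e _ i = ≤-reflexive (cong (u i (sgn t) ∘ bndColors ℓ) (toℕ-injective (sym e)))
          go (suc d) t' e pos-eq i = ≤-trans (go d t'' (toℕ-fromℕ< d<N) pos-eq' i)
              (subst (λ k → u i (sgnOf (bcol k)) (bndColors ℓ t'') ≤ u i (sgnOf (bcol k)) (bndColors ℓ t')) (sym pos-eq')
                (sorted-next t'' t' (trans e (cong suc (sym (toℕ-fromℕ< d<N)))) (trans (sym pos-eq') pos-eq) i))
            where
              d<N : d + toℕ t < N
              d<N = subst (_≤ N) e (<⇒≤ (toℕ<n t'))
              t'' = fromℕ< d<N
              pos-eq' : bpv t ≡ bpv t''
              pos-eq' = toℕ-injective (≤-antisym
                (bp-mono t t'' (≤-trans (m≤n+m (toℕ t) d) (≤-reflexive (sym (toℕ-fromℕ< d<N)))))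
                (≤-trans (bp-mono t'' t' (≤-trans (≤-reflexive (toℕ-fromℕ< d<N)) (≤-trans (n≤1+n _) (≤-reflexive (sym e)))))
                  (≤-reflexive (cong toℕ (sym pos-eq)))))

      -- Equal monomials give equal boundary colours by `exponent-rigid`, and `run-rigid` carries
      -- these to all edges.
      unique : ∀ ℓ' → Proper ℓ' →
        (∀ i r → exponent (bndColors ℓ') i r ≡ exponent (bndColors ℓ) i r) → ℓ' ≗ ℓ
      unique ℓ' p same e = trans (sym (Γ-edge ℓ' black e)) (trans (proj₁ (All.lookup tinted (∈-lookup {xs = es} _))) (sym (ℓ-gc e)))
        where
          agrees : ∀ t → Agrees (Γ ℓ') (start t)
          agrees t = trans (Γ-bnd ℓ' t) (trans
            (exponent-rigid bp-mono (bndColors ℓ) (bndColors ℓ') (dominated ℓ' p) sorted same t) (ℓ-bnd t))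
          tinted : All (Tinted (Γ ℓ')) es
          tinted = run-rigid (Γ ℓ') (Γ-proper ℓ' p) run (Γ-compatible ℓ') (tabulate⁺ agrees)

      leading : IsLeading (mon ℓ) × IsUnit (coeff (mon ℓ))
      leading = leading-criterion ℓ ℓ-proper
        (λ ℓ' p → not-firstLess bp-mono (bndColors ℓ) (bndColors ℓ') (dominated ℓ' p)) unique

theorem5p1 : (D : Web) → NonElliptic D → (ℓ : Fin (W.E D) → Col) → KKColoring D ℓ →
    Inv.IsLeading D (Inv.mon D ℓ)
    × ((Inv.coeff D (Inv.mon D ℓ) ≡ 1ℤ) ⊎ (Inv.coeff D (Inv.mon D ℓ) ≡ -1ℤ))
theorem5p1 D (simple , _) ℓ (str , _ , signs , F , steps , empty , φV , φE , r , int-end , bnd-end , ℓ-gc)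
  with steps⇒run steps empty
... | es , done≡es , run = Leading.leading simple str signs ℓ ℓ-gc
        (subst₂ (λ L es → Run 0 L (GState.nxt F) es) (map-tabulate {n = W.N D} id _) (sym done≡es) run)
  where open Diagram.Grown D {es = GState.done F} φV φE r int-end bnd-end
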